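{- Let $k,m,t$ be positive integers with $k\ge 2$, $t,m\ge 2$, and let $r=k+m-1$. Then \[ \tilde R_t(P_r^{(k)})\le |Q_k|\cdot|Q_{k-1}|\prod_{i=1}^{k-1}a_i, \] where $a_i$ is the size of a largest antichain in $Q_i$. Moreover, for any constant $\varepsilon>0$, \[ |Q_3|\cdot|Q_2|\,a_2a_1\le |Q_3|(\lg|Q_3|)^{2+\frac1{t-1}+\varepsilon} \quad\text{and}\quad |Q_k|\cdot|Q_{k-1}|\prod_{i=1}^{k-1}a_i\le |Q_k|(\lg|Q_k|)^{2+\varepsilon}\ \ (\text{for } k\ge4) \] whenever $tm$ is sufficiently large in terms of $\varepsilon$.
   Context: $\lg$ is the base-2 logarithm. $Q_1$ is the poset that is the disjoint union of $t$ chains each with $m-1$ elements; for $j>1$, $Q_j$ is the poset of all down-sets (including the empty set) of $Q_{j-1}$, ordered by inclusion. The monotone tight path $P_r^{(k)}$ is the ordered $k$-uniform hypergraph on $[r]$ whose edges are all $k$-sets of consecutive vertices (it has $m=r-k+1$ edges). The $t$-color on-line size Ramsey number $\tilde R_t(G)$ of an ordered hypergraph $G$ is the minimum number of rounds Builder needs to guarantee a win in the following game: on a large linearly ordered vertex supply, each round Builder presents a new $k$-set and Painter immediately colors it with one of $t$ colors; Builder wins when a monochromatic copy of $G$ respecting the vertex order appears. -}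

module Defs where

open import Data.Bool using (Bool; true; false; _∧_; _∨_; not; if_then_else_)
open import Data.Nat using (ℕ; zero; suc; _+_; _*_; _∸_; _^_; _≤_; _<_; _≡ᵇ_; _≤ᵇ_; _⊔_)
open import Data.Fin using (Fin)
open import Data.List using (List; []; _∷_; map; length; upTo; zip; zipWith; concatMap; foldr)
open import Data.Bool.ListAction using (and; all)
open import Data.Nat.ListAction using (product)
open import Data.List.Membership.Propositional using (_∈_; _∉_)
open import Data.List.Relation.Unary.Linked using (Linked)
open import Data.Product using (_×_; _,_; proj₁; ∃; Σ)
open import Relation.Binary.PropositionalEquality using (_≡_)

-- Finite posets given by an explicit duplicate-free list of elements and
-- a boolean order relation.

record FinPoset : Set₁ where
  field
    El    : Set
    elems : List El
    le    : El → El → Bool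
open FinPoset public

size : FinPoset → ℕ
size P = length (elems P)

bfilter : {A : Set} → (A → Bool) → List A → List A
bfilter p [] = []
bfilter p (x ∷ xs) = if p x then x ∷ bfilter p xs else bfilter p xs

-- all boolean vectors (as lists) of length n: the subsets of an n-element list
allBools : ℕ → List (List Bool)
allBools zero = [] ∷ []
allBools (suc n) = concatMap (λ s → (false ∷ s) ∷ (true ∷ s) ∷ []) (allBools n)

count : List Bool → ℕ
count s = length (bfilter (λ b → b) s)

-- Q_1: disjoint union of t chains, each with m-1 elements.
-- Element (c , l) = l-th element (0-based) of chain c.
Q1 : ℕ → ℕ → FinPoset
Q1 t m = record
  { El = ℕ × ℕ
  ; elems = concatMap (λ c → map (λ l → (c , l)) (upTo (m ∸ 1))) (upTo t)
  ; le = λ { (c , l) (c' , l') → (c ≡ᵇ c') ∧ (l ≤ᵇ l') }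
  }

-- The poset of all down-sets (including ∅) of P, ordered by inclusion.
-- A subset of P is its characteristic vector along elems P.
Downsets : FinPoset → FinPoset
Downsets P = record
  { El = List Bool
  ; elems = bfilter downClosed (allBools (length (elems P)))
  ; le = λ s s' → and (zipWith (λ a b → not a ∨ b) s s')
  }
  where
  downClosed : List Bool → Bool
  downClosed s =
    let ps = zip (elems P) s in
    all (λ { (x , bx) → all (λ { (y , by) → not (by ∧ le P x y) ∨ bx }) ps }) ps

-- Q' t m j = Q_{j+1}
Q' : ℕ → ℕ → ℕ → FinPoset
Q' t m zero = Q1 t m
Q' t m (suc j) = Downsets (Q' t m j)

-- Q t m j = Q_j for j ≥ 1  (Q t m 0 is an unused junk value equal to Q_1)
Q : ℕ → ℕ → ℕ → FinPoset
Q t m j = Q' t m (j ∸ 1)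

isAntichain : (P : FinPoset) → List Bool → Bool
isAntichain P s =
  let ps = zip (upTo (length (elems P))) (zip (elems P) s) in
  all (λ { (i , x , bx) → all (λ { (j , y , by) →
        not (bx ∧ by ∧ not (i ≡ᵇ j) ∧ le P x y) }) ps }) ps

maxAntichain : FinPoset → ℕ
maxAntichain P =
  foldr _⊔_ 0 (map count (bfilter (isAntichain P) (allBools (length (elems P)))))

a : ℕ → ℕ → ℕ → ℕ
a t m i = maxAntichain (Q t m i)

prodA : ℕ → ℕ → ℕ → ℕ
prodA t m n = product (map (λ i → a t m (suc i)) (upTo n))

bound : ℕ → ℕ → ℕ → ℕ
bound k t m = size (Q t m k) * size (Q t m (k ∸ 1)) * prodA t m (k ∸ 1)

-- The on-line Ramsey game for the monotone tight path P_r^{(k)}, r = k+m-1.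
-- Vertex supply: ℕ with its usual order.  A k-set is a strictly increasing
-- list of length k.  History: presented k-sets with Painter's colours.

History : ℕ → Set
History t = List (List ℕ × Fin t)

pathEdge : (ℕ → ℕ) → ℕ → ℕ → List ℕ
pathEdge v k i = map (λ j → v (i + j)) (upTo k)

MonoPath : (k m t : ℕ) → History t → Set
MonoPath k m t h =
  Σ (ℕ → ℕ) λ v → Σ (Fin t) λ c →
    (∀ i → suc i < k + m ∸ 1 → v i < v (suc i)) ×
    (∀ i → i < m → (pathEdge v k i , c) ∈ h)

-- BuilderWins k m t n h : from history h, Builder can force a win within n
-- further rounds against every Painter strategy.
data BuilderWins (k m t : ℕ) : ℕ → History t → Set where
  won  : ∀ {n h} → MonoPath k m t h → BuilderWins k m t n h
  play : ∀ {n h} (e : List ℕ) → length e ≡ k → Linked _<_ e →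
         e ∉ map proj₁ h →
         (∀ (c : Fin t) → BuilderWins k m t n ((e , c) ∷ h)) →
         BuilderWins k m t (suc n) h

OnlineRamseyLe : (k m t N : ℕ) → Set
OnlineRamseyLe k m t N = BuilderWins k m t N []

-- Real-valued inequality  X ≤ Y · (lg Y)^(num/den)  (Y ≥ 1, num, den ≥ 1),
-- expressed exactly via naturals: it is equivalent to
--   lg Y ≥ (X/Y)^(den/num),  i.e. every nonnegative rational a/b with
--   (a/b)^num < (X/Y)^den satisfies a/b ≤ lg Y, i.e. 2^a ≤ Y^b.
LgBound : (X Y num den : ℕ) → Set
LgBound X Y num den =
  ∀ (x b : ℕ) → 0 < b → x ^ num * Y ^ den < b ^ num * X ^ den → 2 ^ x ≤ Y ^ b

{-# OPTIONS --safe #-}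

-- Builder introduces the vertices 0, 1, 2, … in order and, while treating n, only presents edges
-- ending in n.  A (k-1)-set S carries, for each colour, the length of the longest monochromatic
-- path known to end in S; as long as Builder has not won this is a down-set of Q₁, that is, an
-- element of Q₂.  A smaller set S is labelled by the down-set generated by the labels of the sets
-- u ∷ S with u before S, so that single vertices carry elements of Q_k.  Presenting an edge T
-- makes label (tail T) ⊄ label (init T); to achieve the same for a shorter T it suffices to do so
-- for u ∷ T, where u runs over representatives of the maximal labels of the sets u ∷ init T, which
-- form an antichain.  Hence two vertices are separated in a₂ ⋯ a_{k-1} rounds.  As long as the
-- label of n coincides with that of an earlier vertex, separating the two enlarges the label of n,
-- which happens at most |Q_{k-1}| times; and there are at most |Q_k| distinct labels.
--
-- For the logarithmic bounds, the subsets of an antichain generate distinct down-sets, so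
-- 2 ^ a_i ≤ |Q_{i+1}|, and down-sets of equal cardinality form an antichain, so
-- |Q_{i+1}| ≤ (|Q_i| + 1) a_{i+1}.  Together with m ^ t ≤ |Q₂| these give |Q_i| and a₁ ⋯ a_i
-- polynomial in a_i, and a_{i+1} superpolynomial in a_i.
module Submission where

open import Defs
open import Data.Bool using (Bool; true; false; _∧_; _∨_; not)
import Data.Bool.Properties as Bool
open import Data.Bool.ListAction using (and; all; any)
open import Data.Empty using (⊥; ⊥-elim)
open import Data.Fin using (Fin; toℕ)
import Data.Fin.Properties as Fin
open import Data.List using (List; []; _∷_; _++_; _∷ʳ_; map; length; upTo; applyUpTo; zip; zipWith; concatMap; foldr; cartesianProduct; cartesianProductWith)
open import Data.List.Properties
open import Data.List.Membership.Propositional using (_∈_; _∉_; find; lose)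
open import Data.List.Membership.Propositional.Properties
open import Data.List.Relation.Unary.All as All using (All; []; _∷_)
import Data.List.Relation.Unary.All.Properties as All
open import Data.List.Relation.Unary.AllPairs using (AllPairs; []; _∷_)
import Data.List.Relation.Unary.AllPairs.Properties as AllPairs
open import Data.List.Relation.Unary.Any using (here; there; any?)
open import Data.List.Relation.Unary.Linked using (Linked; []; [-]; _∷_)
open import Data.List.Relation.Unary.Unique.Propositional using (Unique)
import Data.List.Relation.Unary.Unique.Propositional.Properties as Unique
open import Data.Nat
open import Data.Nat.DivMod using (m/n*n≤m; m%n<n; m≡m%n+[m/n]*n; /-mono-≤; m*n/n≡m)
open import Data.Nat.ListAction using (product)
open import Data.Nat.ListAction.Properties using (product-++)
open import Data.Nat.Properties
open import Data.Nat.Tactic.RingSolver using (solve-∀)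
open import Data.Product using (_×_; _,_; proj₁; proj₂; ∃; Σ)
import Data.Product.Properties as Product
open import Data.Sum using (inj₁; inj₂)
open import Function using (_∘_; id; case_of_)
open import Relation.Binary.Definitions using (DecidableEquality)
open import Relation.Binary.PropositionalEquality
open import Relation.Nullary using (¬_; yes; no; does)
open import Relation.Nullary.Decidable using (dec-true)

private
  variable
    X Y Z : Set

-- Booleans and lists

∧-true : ∀ {x y} → x ∧ y ≡ true → x ≡ true × y ≡ true
∧-true {true} {true} _ = refl , refl

true∧ : ∀ {x y} → x ≡ true → y ≡ true → x ∧ y ≡ true
true∧ refl refl = refl

⇒-elim : ∀ {x y} → not x ∨ y ≡ true → x ≡ true → y ≡ true
⇒-elim {true} p refl = p

⇒-intro : ∀ {x y} → (x ≡ true → y ≡ true) → not x ∨ y ≡ true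
⇒-intro {true}  f = f refl
⇒-intro {false} f = refl

¬true⇒false : ∀ {x} → ¬ x ≡ true → x ≡ false
¬true⇒false {true}  f = ⊥-elim (f refl)
¬true⇒false {false} f = refl

≡ᵇ-true⇒≡ : ∀ {i j} → (i ≡ᵇ j) ≡ true → i ≡ j
≡ᵇ-true⇒≡ {i} {j} p = ≡ᵇ⇒≡ i j (subst Data.Bool.T (sym p) _)

≡ᵇ-refl : ∀ i → (i ≡ᵇ i) ≡ true
≡ᵇ-refl zero    = refl
≡ᵇ-refl (suc i) = ≡ᵇ-refl i

≤ᵇ-true⇒≤ : ∀ {i j} → (i ≤ᵇ j) ≡ true → i ≤ j
≤ᵇ-true⇒≤ {i} {j} p = ≤ᵇ⇒≤ i j (subst Data.Bool.T (sym p) _)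

≤⇒≤ᵇ-true : ∀ {i j} → i ≤ j → (i ≤ᵇ j) ≡ true
≤⇒≤ᵇ-true {i} {j} p with i ≤ᵇ j | ≤⇒≤ᵇ p
... | true | _ = refl

<ᵇ-true⇒< : ∀ {i j} → (i <ᵇ j) ≡ true → i < j
<ᵇ-true⇒< {i} {j} p = <ᵇ⇒< i j (subst Data.Bool.T (sym p) _)

<⇒<ᵇ-true : ∀ {i j} → i < j → (i <ᵇ j) ≡ true
<⇒<ᵇ-true {i} {j} p with i <ᵇ j | <⇒<ᵇ p
... | true | _ = refl

all-elim : ∀ {p : X → Bool} {xs x} → all p xs ≡ true → x ∈ xs → p x ≡ true
all-elim e (here refl) = proj₁ (∧-true e)
all-elim e (there x∈)  = all-elim (proj₂ (∧-true e)) x∈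

all-intro : ∀ {p : X → Bool} xs → (∀ {x} → x ∈ xs → p x ≡ true) → all p xs ≡ true
all-intro []       f = refl
all-intro (x ∷ xs) f = true∧ (f (here refl)) (all-intro xs (f ∘ there))

any-intro : ∀ {p : X → Bool} {xs x} → x ∈ xs → p x ≡ true → any p xs ≡ true
any-intro (here refl) e rewrite e = refl
any-intro {p = p} {y ∷ _} (there x∈) e with p y
... | true  = refl
... | false = any-intro x∈ e

any-elim : ∀ {p : X → Bool} {xs} → any p xs ≡ true → ∃ λ x → x ∈ xs × p x ≡ true
any-elim {p = p} {x ∷ xs} e with p x in q
... | true  = x , here refl , q
... | false with y , y∈ , r ← any-elim {xs = xs} e = y , there y∈ , r

∈-bfilter⁻ : ∀ {p : X → Bool} {x} xs → x ∈ bfilter p xs → x ∈ xs × p x ≡ true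
∈-bfilter⁻ {p = p} (y ∷ ys) x∈ with p y in e
∈-bfilter⁻ (y ∷ ys) (here refl) | true = here refl , e
∈-bfilter⁻ (y ∷ ys) (there x∈)  | true with q , r ← ∈-bfilter⁻ ys x∈ = there q , r
∈-bfilter⁻ (y ∷ ys) x∈ | false with q , r ← ∈-bfilter⁻ ys x∈ = there q , r

∈-bfilter⁺ : ∀ {p : X → Bool} {x xs} → x ∈ xs → p x ≡ true → x ∈ bfilter p xs
∈-bfilter⁺ (here refl) e rewrite e = here refl
∈-bfilter⁺ {p = p} {xs = y ∷ _} (there x∈) e with p y
... | true  = there (∈-bfilter⁺ x∈ e)
... | false = ∈-bfilter⁺ x∈ e

bfilter-AllPairs : ∀ {R : X → X → Set} {p : X → Bool} {xs} → AllPairs R xs → AllPairs R (bfilter p xs)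
bfilter-AllPairs [] = []
bfilter-AllPairs {p = p} {x ∷ xs} (Rx ∷ Rxs) with p x
... | true  = All.tabulate (λ y∈ → All.lookup Rx (proj₁ (∈-bfilter⁻ xs y∈))) ∷ bfilter-AllPairs Rxs
... | false = bfilter-AllPairs Rxs

count-map : ∀ (f : X → Bool) xs → count (map f xs) ≡ length (bfilter f xs)
count-map f [] = refl
count-map f (x ∷ xs) with f x
... | true  = cong suc (count-map f xs)
... | false = count-map f xs

map-cong-∈ : ∀ {f g : X → Y} {xs} → (∀ {x} → x ∈ xs → f x ≡ g x) → map f xs ≡ map g xs
map-cong-∈ = map-cong-local ∘ All.tabulate

map-≡⇒∈ : ∀ {f g : X → Y} {xs x} → map f xs ≡ map g xs → x ∈ xs → f x ≡ g x
map-≡⇒∈ e (here refl) = ∷-injectiveˡ e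
map-≡⇒∈ e (there x∈)  = map-≡⇒∈ (∷-injectiveʳ e) x∈

∈-zip-map⁻ : ∀ {f : X → Y} xs {x b} → (x , b) ∈ zip xs (map f xs) → x ∈ xs × b ≡ f x
∈-zip-map⁻ (y ∷ xs) (here refl) = here refl , refl
∈-zip-map⁻ (y ∷ xs) (there p) with q , r ← ∈-zip-map⁻ xs p = there q , r

∈-zip⁻ : ∀ (xs : List X) (ys : List Y) {x y} → (x , y) ∈ zip xs ys → x ∈ xs × y ∈ ys
∈-zip⁻ (_ ∷ xs) (_ ∷ ys) (here refl) = here refl , here refl
∈-zip⁻ (_ ∷ xs) (_ ∷ ys) (there p) with q , r ← ∈-zip⁻ xs ys p = there q , there r

∈-remove : ∀ {x z : X} as {bs} → z ∈ as ++ x ∷ bs → ¬ z ≡ x → z ∈ as ++ bs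
∈-remove as z∈ z≢x with ∈-++⁻ as z∈
... | inj₁ p         = ∈-++⁺ˡ p
... | inj₂ (here e)  = ⊥-elim (z≢x e)
... | inj₂ (there p) = ∈-++⁺ʳ as p

-- Induction on `xs`: after one occurrence of `f x` is deleted from `ys`, injectivity keeps the
-- images of the remaining entries in what is left.
injection⇒length≤ : ∀ {xs : List X} {ys : List Y} (f : X → Y) → Unique xs →
  (∀ {x} → x ∈ xs → f x ∈ ys) →
  (∀ {x y} → x ∈ xs → y ∈ xs → f x ≡ f y → x ≡ y) → length xs ≤ length ys
injection⇒length≤ f [] _ _ = z≤n
injection⇒length≤ {xs = x ∷ xs} f (x∉ ∷ u) f∈ inj with ∈-∃++ (f∈ (here refl))
... | as , bs , refl = begin
    suc (length xs)         ≤⟨ s≤s (injection⇒length≤ f u f∈′ (λ p q → inj (there p) (there q))) ⟩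
    suc (length (as ++ bs)) ≡⟨ cong suc (length-++ as) ⟩
    suc (length as + length bs) ≡⟨ +-suc (length as) (length bs) ⟨
    length as + suc (length bs) ≡⟨ length-++ as ⟨
    length (as ++ f x ∷ bs) ∎
  where
  open ≤-Reasoning
  f∈′ : ∀ {y} → y ∈ xs → f y ∈ as ++ bs
  f∈′ y∈ = ∈-remove as (f∈ (there y∈))
    (λ e → All.lookup x∉ y∈ (sym (inj (there y∈) (here refl) e)))

⊆⇒length≤ : ∀ {xs ys : List X} → Unique xs → (∀ {x} → x ∈ xs → x ∈ ys) → length xs ≤ length ys
⊆⇒length≤ u xs⊆ys = injection⇒length≤ id u xs⊆ys (λ _ _ → id)

length-cartesianProductWith : ∀ (f : X → Y → Z) xs ys →
  length (cartesianProductWith f xs ys) ≡ length xs * length ys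
length-cartesianProductWith f []       ys = refl
length-cartesianProductWith f (x ∷ xs) ys = trans (length-++ (map (f x) ys))
  (cong₂ _+_ (length-map (f x) ys) (length-cartesianProductWith f xs ys))

-- Boolean vectors

∈-allBools⁻ : ∀ n {s} → s ∈ allBools n → length s ≡ n
∈-allBools⁻ zero (here refl) = refl
∈-allBools⁻ (suc n) p = go (allBools n) (∈-allBools⁻ n) p
  where
  go : ∀ ss → (∀ {s} → s ∈ ss → length s ≡ n) →
    ∀ {s} → s ∈ concatMap (λ s → (false ∷ s) ∷ (true ∷ s) ∷ []) ss → length s ≡ suc n
  go (s ∷ ss) h (here refl)         = cong suc (h (here refl))
  go (s ∷ ss) h (there (here refl)) = cong suc (h (here refl))
  go (s ∷ ss) h (there (there q))   = go ss (h ∘ there) q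

∈-allBools⁺ : ∀ s → s ∈ allBools (length s)
∈-allBools⁺ []      = here refl
∈-allBools⁺ (b ∷ s) = go b (∈-allBools⁺ s)
  where
  go : ∀ b {ss} → s ∈ ss → b ∷ s ∈ concatMap (λ s → (false ∷ s) ∷ (true ∷ s) ∷ []) ss
  go false (here refl) = here refl
  go true  (here refl) = there (here refl)
  go b     (there p)   = there (there (go b p))

length-allBools : ∀ n → length (allBools n) ≡ 2 ^ n
length-allBools zero    = refl
length-allBools (suc n) = trans (go (allBools n)) (cong (2 *_) (length-allBools n))
  where
  go : ∀ ss → length (concatMap (λ s → (false ∷ s) ∷ (true ∷ s) ∷ []) ss) ≡ 2 * length ss
  go []       = refl
  go (s ∷ ss) = trans (cong (suc ∘ suc) (go ss)) (sym (*-suc 2 (length ss)))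

allBools-unique : ∀ n → Unique (allBools n)
allBools-unique zero    = [] ∷ []
allBools-unique (suc n) = go (allBools-unique n)
  where
  ∈-go : ∀ ss {b s} → b ∷ s ∈ concatMap (λ s → (false ∷ s) ∷ (true ∷ s) ∷ []) ss → s ∈ ss
  ∈-go (s ∷ ss) (here refl)         = here refl
  ∈-go (s ∷ ss) (there (here refl)) = here refl
  ∈-go (s ∷ ss) (there (there p))   = there (∈-go ss p)

  go : ∀ {ss} → Unique ss → Unique (concatMap (λ s → (false ∷ s) ∷ (true ∷ s) ∷ []) ss)
  go []               = []
  go {s ∷ ss} (s∉ ∷ u) =
    ((λ ()) ∷ All.tabulate (λ { q refl → All.lookup s∉ (∈-go ss q) refl })) ∷
    (All.tabulate (λ { q refl → All.lookup s∉ (∈-go ss q) refl }) ∷ go u)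

infix 5 _⊑_
_⊑_ : List Bool → List Bool → Bool
s ⊑ s′ = and (zipWith (λ a b → not a ∨ b) s s′)

⊑-refl : ∀ s → s ⊑ s ≡ true
⊑-refl []          = refl
⊑-refl (true  ∷ s) = ⊑-refl s
⊑-refl (false ∷ s) = ⊑-refl s

⊑-trans : ∀ s s′ s″ → length s ≡ length s′ → length s′ ≡ length s″ →
  s ⊑ s′ ≡ true → s′ ⊑ s″ ≡ true → s ⊑ s″ ≡ true
⊑-trans [] _ _ _ _ _ _ = refl
⊑-trans (x ∷ s) (y ∷ s′) (z ∷ s″) e e′ p q
  with p₁ , p₂ ← ∧-true p | q₁ , q₂ ← ∧-true q =
  true∧ (⇒-intro (⇒-elim {y} q₁ ∘ ⇒-elim {x} p₁))
        (⊑-trans s s′ s″ (suc-injective e) (suc-injective e′) p₂ q₂)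

count-mono : ∀ s s′ → length s ≡ length s′ → s ⊑ s′ ≡ true → count s ≤ count s′
count-mono [] _ _ _ = z≤n
count-mono (true  ∷ s) (true  ∷ s′) e p = s≤s (count-mono s s′ (suc-injective e) p)
count-mono (false ∷ s) (true  ∷ s′) e p = m≤n⇒m≤1+n (count-mono s s′ (suc-injective e) p)
count-mono (false ∷ s) (false ∷ s′) e p = count-mono s s′ (suc-injective e) p

⊑∧count≥⇒≡ : ∀ s s′ → length s ≡ length s′ → s ⊑ s′ ≡ true → count s′ ≤ count s → s ≡ s′
⊑∧count≥⇒≡ [] [] _ _ _ = refl
⊑∧count≥⇒≡ (true  ∷ s) (true  ∷ s′) e p c = cong (true ∷_) (⊑∧count≥⇒≡ s s′ (suc-injective e) p (≤-pred c))
⊑∧count≥⇒≡ (false ∷ s) (true  ∷ s′) e p c =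
  ⊥-elim (<⇒≱ c (count-mono s s′ (suc-injective e) p))
⊑∧count≥⇒≡ (false ∷ s) (false ∷ s′) e p c = cong (false ∷_) (⊑∧count≥⇒≡ s s′ (suc-injective e) p c)

count≤length : ∀ s → count s ≤ length s
count≤length []          = z≤n
count≤length (true  ∷ s) = s≤s (count≤length s)
count≤length (false ∷ s) = m≤n⇒m≤1+n (count≤length s)

map-⊑⁺ : ∀ {f g : X → Bool} xs → (∀ {x} → x ∈ xs → f x ≡ true → g x ≡ true) →
  map f xs ⊑ map g xs ≡ true
map-⊑⁺ []       h = refl
map-⊑⁺ (x ∷ xs) h = true∧ (⇒-intro (h (here refl))) (map-⊑⁺ xs (h ∘ there))

map-⊑⁻ : ∀ {f g : X → Bool} {xs x} → map f xs ⊑ map g xs ≡ true → x ∈ xs → f x ≡ true → g x ≡ true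
map-⊑⁻ {xs = _ ∷ _} p (here refl) = ⇒-elim (proj₁ (∧-true p))
map-⊑⁻ {xs = _ ∷ _} p (there x∈)  = map-⊑⁻ (proj₂ (∧-true p)) x∈

-- Finite posets

-- The order laws are confined to listed elements because `⊑` stops at the end of the shorter vector
-- and is not transitive across different lengths.
record IsPoset (P : FinPoset) : Set where
  field
    unique  : Unique (elems P)
    ≼-refl  : ∀ {x} → x ∈ elems P → le P x x ≡ true
    ≼-trans : ∀ {x y z} → x ∈ elems P → y ∈ elems P → z ∈ elems P →
              le P x y ≡ true → le P y z ≡ true → le P x z ≡ true

∈-Downsets⇒length : ∀ P {s} → s ∈ elems (Downsets P) → length s ≡ size P
∈-Downsets⇒length P s∈ = ∈-allBools⁻ (size P) (proj₁ (∈-bfilter⁻ (allBools (size P)) s∈))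

Downsets-isPoset : ∀ P → IsPoset (Downsets P)
Downsets-isPoset P = record
  { unique  = bfilter-AllPairs (allBools-unique (size P))
  ; ≼-refl  = λ {s} _ → ⊑-refl s
  ; ≼-trans = λ {s} {s′} {s″} s∈ s′∈ s″∈ → ⊑-trans s s′ s″ (same s∈ s′∈) (same s′∈ s″∈)
  }
  where
  same : ∀ {s s′} → s ∈ elems (Downsets P) → s′ ∈ elems (Downsets P) → length s ≡ length s′
  same s∈ s′∈ = trans (∈-Downsets⇒length P s∈) (sym (∈-Downsets⇒length P s′∈))

Q1-elems : ∀ t m → elems (Q1 t m) ≡ cartesianProduct (upTo t) (upTo (m ∸ 1))
Q1-elems t m = go (upTo t)
  where
  go : ∀ xs → concatMap (λ c → map (λ l → (c , l)) (upTo (m ∸ 1))) xs ≡ cartesianProduct xs (upTo (m ∸ 1))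
  go []       = refl
  go (x ∷ xs) = cong (map (x ,_) (upTo (m ∸ 1)) ++_) (go xs)

size-Q1 : ∀ t m → size (Q1 t m) ≡ t * (m ∸ 1)
size-Q1 t m = begin
  length (elems (Q1 t m))                      ≡⟨ cong length (Q1-elems t m) ⟩
  length (cartesianProduct (upTo t) (upTo (m ∸ 1))) ≡⟨ length-cartesianProductWith _,_ (upTo t) (upTo (m ∸ 1)) ⟩
  length (upTo t) * length (upTo (m ∸ 1))      ≡⟨ cong₂ _*_ (length-upTo t) (length-upTo (m ∸ 1)) ⟩
  t * (m ∸ 1)                                  ∎
  where open ≡-Reasoning

∈-Q1⁻ : ∀ t m {c l} → (c , l) ∈ elems (Q1 t m) → c < t × l < m ∸ 1
∈-Q1⁻ t m p with ∈-cartesianProduct⁻ (upTo t) (upTo (m ∸ 1)) (subst (_ ∈_) (Q1-elems t m) p)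
... | q , r = ∈-upTo⁻ q , ∈-upTo⁻ r

∈-Q1⁺ : ∀ t m {c l} → c < t → l < m ∸ 1 → (c , l) ∈ elems (Q1 t m)
∈-Q1⁺ t m c< l< = subst (_ ∈_) (sym (Q1-elems t m)) (∈-cartesianProduct⁺ (∈-upTo⁺ c<) (∈-upTo⁺ l<))

Q1-isPoset : ∀ t m → IsPoset (Q1 t m)
Q1-isPoset t m = record
  { unique  = subst Unique (sym (Q1-elems t m)) (Unique.cartesianProduct⁺ (Unique.upTo⁺ t) (Unique.upTo⁺ (m ∸ 1)))
  ; ≼-refl  = λ {x} _ → true∧ (≡ᵇ-refl (proj₁ x)) (≤⇒≤ᵇ-true {proj₂ x} ≤-refl)
  ; ≼-trans = λ {x} {y} {z} _ _ _ → tr {x} {y} {z}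
  }
  where
  tr : ∀ {x y z} → le (Q1 t m) x y ≡ true → le (Q1 t m) y z ≡ true → le (Q1 t m) x z ≡ true
  tr {c , l} {c′ , l′} {c″ , l″} p q
    with p₁ , p₂ ← ∧-true {c ≡ᵇ c′} p | q₁ , q₂ ← ∧-true {c′ ≡ᵇ c″} q
    with refl ← ≡ᵇ-true⇒≡ {c} p₁ | refl ← ≡ᵇ-true⇒≡ {c′} q₁ =
    true∧ (≡ᵇ-refl c) (≤⇒≤ᵇ-true {l} (≤-trans (≤ᵇ-true⇒≤ {l} p₂) (≤ᵇ-true⇒≤ {l′} q₂)))

Q'-isPoset : ∀ t m j → IsPoset (Q' t m j)
Q'-isPoset t m zero    = Q1-isPoset t m
Q'-isPoset t m (suc j) = Downsets-isPoset (Q' t m j)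

IsDownset : (P : FinPoset) → (El P → Bool) → Set
IsDownset P f = ∀ {x y} → x ∈ elems P → y ∈ elems P → le P x y ≡ true → f y ≡ true → f x ≡ true

vec : (P : FinPoset) → (El P → Bool) → List Bool
vec P f = map f (elems P)

vec∈Downsets : ∀ P {f} → IsDownset P f → vec P f ∈ elems (Downsets P)
vec∈Downsets P {f} down = ∈-bfilter⁺
  (subst (λ n → vec P f ∈ allBools n) (length-map f (elems P)) (∈-allBools⁺ (vec P f)))
  (all-intro ps λ {(x , bx)} x∈ → all-intro ps λ {(y , by)} y∈ → closed (∈-zip-map⁻ (elems P) x∈) (∈-zip-map⁻ (elems P) y∈))
  where
  ps = zip (elems P) (vec P f)

  closed : ∀ {x bx y by} → x ∈ elems P × bx ≡ f x → y ∈ elems P × by ≡ f y → not (by ∧ le P x y) ∨ bx ≡ true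
  closed {y = y} (x∈ , refl) (y∈ , refl) = ⇒-intro λ p → let q , r = ∧-true {f y} p in down x∈ y∈ r q

↓ : (P : FinPoset) → List (El P) → El P → Bool
↓ P ys x = any (le P x) ys

↓-isDownset : ∀ {P} → IsPoset P → ∀ {ys} → (∀ {y} → y ∈ ys → y ∈ elems P) → IsDownset P (↓ P ys)
↓-isDownset isP ys⊆ x∈ y∈ x≼y p with z , z∈ , y≼z ← any-elim p =
  any-intro z∈ (IsPoset.≼-trans isP x∈ y∈ (ys⊆ z∈) x≼y y≼z)

-- Antichains

Incomparable : (P : FinPoset) → El P → El P → Set
Incomparable P x y = le P x y ≡ false × le P y x ≡ false

maximum-elim : ∀ (R : ℕ → Set) ns → R 0 → (∀ {n} → n ∈ ns → R n) → R (foldr _⊔_ 0 ns)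
maximum-elim R []       r h = r
maximum-elim R (n ∷ ns) r h with ⊔-sel n (foldr _⊔_ 0 ns)
... | inj₁ e = subst R (sym e) (h (here refl))
... | inj₂ e = subst R (sym e) (maximum-elim R ns r (h ∘ there))

∈⇒≤maximum : ∀ {n ns} → n ∈ ns → n ≤ foldr _⊔_ 0 ns
∈⇒≤maximum (here refl) = m≤m⊔n _ _
∈⇒≤maximum {ns = k ∷ ns} (there p) = ≤-trans (∈⇒≤maximum p) (m≤n⊔m k _)

-- `isAntichain` tells entries apart by index rather than by value; as `xs` has no repetitions,
-- equal values carry equal indices.
zip-index-unique : ∀ {is : List X} {xs : List Y} {s : List Z} {i j x b b′} → Unique xs →
  (i , x , b) ∈ zip is (zip xs s) → (j , x , b′) ∈ zip is (zip xs s) → i ≡ j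
zip-index-unique {is = _ ∷ _} {_ ∷ _} {_ ∷ _} _ (here refl) (here refl) = refl
zip-index-unique {is = _ ∷ is} {_ ∷ xs} {_ ∷ s} (x∉ ∷ _) (here refl) (there q) =
  ⊥-elim (All.lookup x∉ (proj₁ (∈-zip⁻ xs s (proj₂ (∈-zip⁻ is (zip xs s) q)))) refl)
zip-index-unique {is = _ ∷ is} {_ ∷ xs} {_ ∷ s} (x∉ ∷ _) (there p) (here refl) =
  ⊥-elim (All.lookup x∉ (proj₁ (∈-zip⁻ xs s (proj₂ (∈-zip⁻ is (zip xs s) p)))) refl)
zip-index-unique {is = _ ∷ _} {_ ∷ _} {_ ∷ _} (_ ∷ u) (there p) (there q) = zip-index-unique u p q

antichain⇒≤maxAntichain : ∀ {P} → IsPoset P → (f : El P → Bool) →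
  (∀ {x y} → x ∈ elems P → y ∈ elems P → f x ≡ true → f y ≡ true → le P x y ≡ true → x ≡ y) →
  length (bfilter f (elems P)) ≤ maxAntichain P
antichain⇒≤maxAntichain {P} isP f anti =
  subst (_≤ maxAntichain P) (count-map f (elems P)) (∈⇒≤maximum (∈-map⁺ count vec∈))
  where
  ps = zip (upTo (size P)) (zip (elems P) (vec P f))

  fx : ∀ {i x bx} → (i , x , bx) ∈ ps → x ∈ elems P × bx ≡ f x
  fx p = ∈-zip-map⁻ (elems P) (proj₂ (∈-zip⁻ (upTo (size P)) _ p))

  ok : ∀ {i x bx j y by} → (i , x , bx) ∈ ps → (j , y , by) ∈ ps →
    ¬ (bx ∧ by ∧ not (i ≡ᵇ j) ∧ le P x y ≡ true)
  ok {i} {x} {bx} {j} {y} {by} p q e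
    with e₁ , e′ ← ∧-true {bx} e | x∈ , bx≡ ← fx p | y∈ , by≡ ← fx q
    with e₂ , e″ ← ∧-true {by} e′
    with e₃ , e₄ ← ∧-true {not (i ≡ᵇ j)} e″
    with refl ← anti x∈ y∈ (trans (sym bx≡) e₁) (trans (sym by≡) e₂) e₄
    with refl ← zip-index-unique {is = upTo (size P)} (IsPoset.unique isP) p q
    rewrite ≡ᵇ-refl i = case e₃ of λ ()

  vec∈ : vec P f ∈ bfilter (isAntichain P) (allBools (size P))
  vec∈ = ∈-bfilter⁺
    (subst (λ n → vec P f ∈ allBools n) (length-map f (elems P)) (∈-allBools⁺ (vec P f)))
    (all-intro ps λ {(i , x , bx)} p → all-intro ps λ {(j , y , by)} q →
      cong not (¬true⇒false (ok {i} {x} {bx} {j} {y} {by} p q)))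

incomparable⇒≤maxAntichain : ∀ {P} → DecidableEquality (El P) → IsPoset P → ∀ {ys} →
  (∀ {y} → y ∈ ys → y ∈ elems P) → AllPairs (Incomparable P) ys → length ys ≤ maxAntichain P
incomparable⇒≤maxAntichain {P} _≟P_ isP {ys} ys⊆ anti = ≤-trans
  (⊆⇒length≤ (distinct ys⊆ anti) λ {y} y∈ → ∈-bfilter⁺ (ys⊆ y∈) (dec-true (y ∈? ys) y∈))
  (antichain⇒≤maxAntichain isP (λ x → does (x ∈? ys)) λ {x} {y} _ _ x∈ y∈ x≼y →
    case ∈-AllPairs₂ anti (does⇒∈ x x∈) (does⇒∈ y y∈) of λ where
      (inj₁ x≡y)             → x≡y
      (inj₂ (inj₁ (x⋠y , _))) → case trans (sym x≼y) x⋠y of λ ()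
      (inj₂ (inj₂ (_ , x⋠y))) → case trans (sym x≼y) x⋠y of λ ())
  where
  open import Data.List.Membership.DecPropositional _≟P_ using (_∈?_)

  does⇒∈ : ∀ x → does (x ∈? ys) ≡ true → x ∈ ys
  does⇒∈ x e with yes x∈ ← x ∈? ys = x∈

  distinct : ∀ {ys} → (∀ {y} → y ∈ ys → y ∈ elems P) → AllPairs (Incomparable P) ys → Unique ys
  distinct ys⊆ []         = []
  distinct ys⊆ (y# ∷ ys#) =
    All.map (λ { (y⋠z , _) refl → case trans (sym (IsPoset.≼-refl isP (ys⊆ (here refl)))) y⋠z of λ () }) y#
    ∷ distinct (ys⊆ ∘ there) ys#

-- Indices of the maximal members of a family, one index for each of them.
maximal : ∀ {P} → IsPoset P → (g : X → El P) → (∀ u → g u ∈ elems P) → ∀ us → ∃ λ vs →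
  (∀ {v} → v ∈ vs → v ∈ us) ×
  (∀ {u} → u ∈ us → ∃ λ v → v ∈ vs × le P (g u) (g v) ≡ true) ×
  AllPairs (λ u v → Incomparable P (g u) (g v)) vs
maximal isP g g∈ [] = [] , (λ ()) , (λ ()) , []
maximal {P = P} isP g g∈ (u ∷ us) with maximal {P = P} isP g g∈ us
... | vs , vs⊆ , dom , anti with any (λ v → le P (g u) (g v)) vs in e
... | true = vs , there ∘ vs⊆ , dom′ , anti
  where
  dom′ : ∀ {w} → w ∈ u ∷ us → ∃ λ v → v ∈ vs × le P (g w) (g v) ≡ true
  dom′ (here refl) = any-elim e
  dom′ (there w∈)  = dom w∈
... | false = u ∷ bfilter keep vs , sub , dom′ ,
    All.tabulate (λ v∈ → let v∈′ , kv = ∈-bfilter⁻ vs v∈ in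
      ¬true⇒false (λ u≼v → case trans (sym e) (any-intro v∈′ u≼v) of λ ()) ,
      ¬true⇒false (λ v≼u → case trans (sym (cong not v≼u)) kv of λ ()))
    ∷ bfilter-AllPairs anti
  where
  keep = λ v → not (le P (g v) (g u))

  sub : ∀ {v} → v ∈ u ∷ bfilter keep vs → v ∈ u ∷ us
  sub (here refl) = here refl
  sub (there v∈)  = there (vs⊆ (proj₁ (∈-bfilter⁻ vs v∈)))

  dom′ : ∀ {w} → w ∈ u ∷ us → ∃ λ v → v ∈ u ∷ bfilter keep vs × le P (g w) (g v) ≡ true
  dom′ (here refl) = u , here refl , IsPoset.≼-refl isP (g∈ u)
  dom′ {w} (there w∈) with v , v∈ , w≼v ← dom w∈ with le P (g v) (g u) in e′
  ... | true  = u , here refl , IsPoset.≼-trans isP (g∈ w) (g∈ v) (g∈ u) w≼v e′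
  ... | false = v , there (∈-bfilter⁺ v∈ (cong not e′)) , w≼v

-- Antichains and the number of down-sets

select : List X → List Bool → List X
select (x ∷ xs) (true  ∷ s) = x ∷ select xs s
select (x ∷ xs) (false ∷ s) = select xs s
select _        _           = []

length-select : ∀ (xs : List X) s → length s ≡ length xs → length (select xs s) ≡ count s
length-select []       []          _ = refl
length-select (x ∷ xs) (true  ∷ s) e = cong suc (length-select xs s (suc-injective e))
length-select (x ∷ xs) (false ∷ s) e = length-select xs s (suc-injective e)

∈-select⁻ : ∀ (xs : List X) s {x} → x ∈ select xs s → x ∈ xs
∈-select⁻ (y ∷ xs) (true  ∷ s) (here refl) = here refl
∈-select⁻ (y ∷ xs) (true  ∷ s) (there p)   = there (∈-select⁻ xs s p)
∈-select⁻ (y ∷ xs) (false ∷ s) p           = there (∈-select⁻ xs s p)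

∈-select⇒∈-zip : ∀ (is : List Y) (xs : List X) s {x} → length is ≡ length xs →
  x ∈ select xs s → ∃ λ i → i ∈ is × (i , x , true) ∈ zip is (zip xs s)
∈-select⇒∈-zip (i ∷ is) (y ∷ xs) (true ∷ s) e (here refl) = i , here refl , here refl
∈-select⇒∈-zip (i ∷ is) (y ∷ xs) (true ∷ s) e (there p)
  with j , j∈ , q ← ∈-select⇒∈-zip is xs s (suc-injective e) p = j , there j∈ , there q
∈-select⇒∈-zip (i ∷ is) (y ∷ xs) (false ∷ s) e p
  with j , j∈ , q ← ∈-select⇒∈-zip is xs s (suc-injective e) p = j , there j∈ , there q

select-incomparable : ∀ P s → isAntichain P s ≡ true → AllPairs (Incomparable P) (select (elems P) s)
select-incomparable P s anti = go (upTo (size P)) (elems P) s (length-upTo (size P)) (Unique.upTo⁺ (size P))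
  λ {i} {x} {j} {y} p q i≢j → ¬true⇒false λ x≼y →
    absurd i≢j x≼y (all-elim (all-elim anti p) q)
  where
  absurd : ∀ {i j b} → ¬ i ≡ j → b ≡ true → not (not (i ≡ᵇ j) ∧ b) ≡ true → ⊥
  absurd {i} {j} i≢j refl e with i ≡ᵇ j in eq
  ... | true = i≢j (≡ᵇ-true⇒≡ eq)
  absurd i≢j refl () | false

  go : ∀ is xs s → length is ≡ length xs → Unique is →
    (∀ {i x j y} → (i , x , true) ∈ zip is (zip xs s) → (j , y , true) ∈ zip is (zip xs s) →
      ¬ i ≡ j → le P x y ≡ false) →
    AllPairs (Incomparable P) (select xs s)
  go _        []       _           _ _        h = []
  go _        (x ∷ xs) []          _ _        h = []
  go (i ∷ is) (x ∷ xs) (false ∷ s) e (_ ∷ u)  h =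
    go is xs s (suc-injective e) u (λ p q → h (there p) (there q))
  go (i ∷ is) (x ∷ xs) (true  ∷ s) e (i∉ ∷ u) h =
    All.tabulate (λ y∈ → let j , j∈ , q = ∈-select⇒∈-zip is xs s (suc-injective e) y∈
                             i≢j = All.lookup i∉ j∈
                         in h (here refl) (there q) i≢j , h (there q) (here refl) (i≢j ∘ sym))
    ∷ go is xs s (suc-injective e) u (λ p q → h (there p) (there q))

-- The maximum is attained by one of the competing antichains; the empty one accounts for the
-- default 0 of the fold.
maxAntichain-elim : ∀ P (R : ℕ → Set) →
  (∀ ys → (∀ {y} → y ∈ ys → y ∈ elems P) → AllPairs (Incomparable P) ys → R (length ys)) →
  R (maxAntichain P)
maxAntichain-elim P R h = maximum-elim R _ (h [] (λ ()) []) λ n∈ →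
  let s , s∈ , n≡ = ∈-map⁻ count n∈
      s∈′ , anti  = ∈-bfilter⁻ (allBools (size P)) s∈
  in subst R (trans (length-select (elems P) s (∈-allBools⁻ (size P) s∈′)) (sym n≡))
       (h (select (elems P) s) (∈-select⁻ (elems P) s) (select-incomparable P s anti))

2^maxAntichain≤ : ∀ {P} → IsPoset P → 2 ^ maxAntichain P ≤ size (Downsets P)
2^maxAntichain≤ {P} isP = maxAntichain-elim P (λ n → 2 ^ n ≤ size (Downsets P)) λ ys ys⊆ anti →
  subst (_≤ size (Downsets P)) (length-allBools (length ys))
    (injection⇒length≤ (λ s → vec P (↓ P (select ys s))) (allBools-unique (length ys))
      (λ {s} _ → vec∈Downsets P (↓-isDownset isP (ys⊆ ∘ ∈-select⁻ ys s)))
      -- Equal down-closures agree in particular on `ys`, where they spell out `s` and `s′`.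
      (λ {s} {s′} s∈ s′∈ e → trans (sym (recover ys ys⊆ anti s (∈-allBools⁻ _ s∈)))
        (trans (map-cong-∈ (λ y∈ → map-≡⇒∈ e (ys⊆ y∈)))
               (recover ys ys⊆ anti s′ (∈-allBools⁻ _ s′∈)))))
  where
  none : ∀ x ys s → All (λ y → le P x y ≡ false) ys → ↓ P (select ys s) x ≡ false
  none x []       s           []       = refl
  none x (y ∷ ys) []          (p ∷ ps) = refl
  none x (y ∷ ys) (true  ∷ s) (p ∷ ps) rewrite p = none x ys s ps
  none x (y ∷ ys) (false ∷ s) (p ∷ ps) = none x ys s ps

  -- A subset of an antichain is recovered from its down-closure.
  recover : ∀ ys → (∀ {y} → y ∈ ys → y ∈ elems P) → AllPairs (Incomparable P) ys →
    ∀ s → length s ≡ length ys → map (↓ P (select ys s)) ys ≡ s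
  recover []       _   []         []          _ = refl
  recover (y ∷ ys) ys⊆ (y# ∷ ys#) (true ∷ s)  e = cong₂ _∷_
    (cong (_∨ ↓ P (select ys s) y) (IsPoset.≼-refl isP (ys⊆ (here refl))))
    (trans (map-cong-∈ λ {x} x∈ → cong (_∨ ↓ P (select ys s) x) (proj₂ (All.lookup y# x∈)))
           (recover ys (ys⊆ ∘ there) ys# s (suc-injective e)))
  recover (y ∷ ys) ys⊆ (y# ∷ ys#) (false ∷ s) e = cong₂ _∷_
    (none y ys s (All.map proj₁ y#)) (recover ys (ys⊆ ∘ there) ys# s (suc-injective e))

-- The elements with `g` below `n` split into `n` fibres. Later `g` is the cardinality of a
-- down-set, and each fibre is an antichain.
pigeonhole : ∀ (g : X → ℕ) xs a n → (∀ j → length (bfilter (λ x → g x ≡ᵇ j) xs) ≤ a) →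
  length (bfilter (λ x → g x <ᵇ n) xs) ≤ n * a
pigeonhole g xs a zero h = ≤-reflexive (none xs)
  where
  none : ∀ xs → length (bfilter (λ x → g x <ᵇ 0) xs) ≡ 0
  none []       = refl
  none (x ∷ xs) with g x
  ... | _ = none xs
pigeonhole g xs a (suc n) h =
  ≤-trans (split xs) (+-mono-≤ (h n) (pigeonhole g xs a n h))
  where
  open ≤-Reasoning
  split : ∀ xs → length (bfilter (λ x → g x <ᵇ suc n) xs) ≤
                 length (bfilter (λ x → g x ≡ᵇ n) xs) + length (bfilter (λ x → g x <ᵇ n) xs)
  split [] = z≤n
  split (x ∷ xs) with g x <ᵇ suc n in e | g x ≡ᵇ n in e′ | g x <ᵇ n in e″
  ... | true  | true  | true  = s≤s (≤-trans (split xs) (+-monoʳ-≤ (length (bfilter (λ x → g x ≡ᵇ n) xs)) (n≤1+n _)))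
  ... | true  | true  | false = s≤s (split xs)
  ... | true  | false | true  = begin
    _ ≤⟨ s≤s (split xs) ⟩
    _ ≡⟨ +-suc _ _ ⟨
    _ ∎
  ... | false | true  | true  = m≤n⇒m≤1+n (≤-trans (split xs) (+-monoʳ-≤ (length (bfilter (λ x → g x ≡ᵇ n) xs)) (n≤1+n _)))
  ... | false | true  | false = m≤n⇒m≤1+n (split xs)
  ... | false | false | true  = ≤-trans (split xs) (+-monoʳ-≤ (length (bfilter (λ x → g x ≡ᵇ n) xs)) (n≤1+n _))
  ... | false | false | false = split xs
  ... | true  | false | false with m≤n⇒m<n∨m≡n (≤-pred (<ᵇ-true⇒< {g x} {suc n} e))
  ...   | inj₁ lt = case trans (sym e″) (<⇒<ᵇ-true lt) of λ ()
  ...   | inj₂ eq = case trans (sym e′) (trans (cong (_≡ᵇ n) eq) (≡ᵇ-refl n)) of λ ()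

size-Downsets≤ : ∀ P → size (Downsets P) ≤ suc (size P) * maxAntichain (Downsets P)
size-Downsets≤ P = ≤-trans
  -- A cardinality lies between 0 and `size P`, which makes `suc (size P)` levels covering all
  -- down-sets.
  (⊆⇒length≤ (IsPoset.unique isD) (λ {s} s∈ → ∈-bfilter⁺ s∈ (<⇒<ᵇ-true {count s}
    (s≤s (subst (count s ≤_) (∈-Downsets⇒length P s∈) (count≤length s))))))
  (pigeonhole count (elems D) (maxAntichain D) (suc (size P)) λ j →
    antichain⇒≤maxAntichain isD (λ s → count s ≡ᵇ j) λ {s} {s′} s∈ s′∈ e e′ s⊑s′ →
      ⊑∧count≥⇒≡ s s′ (trans (∈-Downsets⇒length P s∈) (sym (∈-Downsets⇒length P s′∈))) s⊑s′
        (≤-reflexive (trans (≡ᵇ-true⇒≡ e′) (sym (≡ᵇ-true⇒≡ {count s} e)))))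
  where
  D = Downsets P
  isD = Downsets-isPoset P

-- The posets Q₁ and Q₂

-- Distinct members of an antichain of Q₁ lie in distinct chains.
a₁≤ : ∀ t m → maxAntichain (Q1 t m) ≤ t
a₁≤ t m = maxAntichain-elim (Q1 t m) (_≤ t) λ ys ys⊆ anti →
  subst₂ _≤_ (length-map proj₁ ys) (length-upTo t)
    (⊆⇒length≤ (chains ys anti) λ c∈ → let y , y∈ , c≡ = ∈-map⁻ proj₁ c∈ in
      subst (_∈ upTo t) (sym c≡) (∈-upTo⁺ (proj₁ (∈-Q1⁻ t m (ys⊆ y∈)))))
  where
  same-chain : ∀ {c l c′ l′} → Incomparable (Q1 t m) (c , l) (c′ , l′) → ¬ c ≡ c′
  same-chain {c} {l} {_} {l′} (p , q) refl rewrite ≡ᵇ-refl c with ≤-total l l′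
  ... | inj₁ l≤ = case trans (sym p) (≤⇒≤ᵇ-true l≤) of λ ()
  ... | inj₂ l≥ = case trans (sym q) (≤⇒≤ᵇ-true l≥) of λ ()

  chains : ∀ ys → AllPairs (Incomparable (Q1 t m)) ys → Unique (map proj₁ ys)
  chains []       []         = []
  chains (y ∷ ys) (y# ∷ ys#) =
    All.map⁺ (All.map (λ {y′} → same-chain {proj₁ y} {proj₂ y} {proj₁ y′} {proj₂ y′}) y#) ∷ chains ys ys#

-- The least elements of the chains 0 and 1 are incomparable. This factor 2 later pays for replacing
-- `suc H` by `H + H`.
2≤a₁ : ∀ {t m} → 2 ≤ t → 2 ≤ m → 2 ≤ maxAntichain (Q1 t m)
2≤a₁ {t} {m} 2≤t 2≤m =
  incomparable⇒≤maxAntichain (Product.≡-dec _≟_ _≟_) (Q1-isPoset t m) {(0 , 0) ∷ (1 , 0) ∷ []}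
    minimal (((refl , refl) ∷ []) ∷ ([] ∷ []))
  where
  0<m-1 = ∸-monoˡ-≤ 1 2≤m

  minimal : ∀ {x} → x ∈ (0 , 0) ∷ (1 , 0) ∷ [] → x ∈ elems (Q1 t m)
  minimal (here refl)         = ∈-Q1⁺ t m (≤-trans (n≤1+n 1) 2≤t) 0<m-1
  minimal (there (here refl)) = ∈-Q1⁺ t m 2≤t 0<m-1

1≤size-Q' : ∀ {t m} → 2 ≤ t → 2 ≤ m → ∀ j → 1 ≤ size (Q' t m j)
1≤size-Q' {t} {m} 2≤t 2≤m zero    =
  subst (1 ≤_) (sym (size-Q1 t m)) (*-mono-≤ (≤-trans (n≤1+n 1) 2≤t) (∸-monoˡ-≤ 1 2≤m))
1≤size-Q' {t} {m} _   _   (suc j) =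
  ≤-trans (m^n>0 2 (maxAntichain (Q' t m j))) (2^maxAntichain≤ (Q'-isPoset t m j))

-- A down-set of `Q₁` is given by how many elements it takes from each chain: `t` numbers, each
-- between 0 and `m ∸ 1`.
heightVectors : ℕ → ℕ → List (List ℕ)
heightVectors m zero    = [] ∷ []
heightVectors m (suc t) = cartesianProductWith _∷_ (upTo m) (heightVectors m t)

length-heightVectors : ∀ m t → length (heightVectors m t) ≡ m ^ t
length-heightVectors m zero    = refl
length-heightVectors m (suc t) = trans (length-cartesianProductWith _∷_ (upTo m) (heightVectors m t))
  (cong₂ _*_ (length-upTo m) (length-heightVectors m t))

heightVectors-unique : ∀ m t → Unique (heightVectors m t)
heightVectors-unique m zero    = [] ∷ []
heightVectors-unique m (suc t) =
  Unique.cartesianProductWith⁺ _∷_ ∷-injective (Unique.upTo⁺ m) (heightVectors-unique m t)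

entry : List ℕ → ℕ → ℕ
entry []       _       = 0
entry (h ∷ hs) zero    = h
entry (h ∷ hs) (suc c) = entry hs c

heightVectors-ext : ∀ m t {hs hs′} → hs ∈ heightVectors m t → hs′ ∈ heightVectors m t →
  (∀ c → c < t → entry hs c < m → entry hs′ c < m → entry hs c ≡ entry hs′ c) → hs ≡ hs′
heightVectors-ext m zero (here refl) (here refl) _ = refl
heightVectors-ext m (suc t) p q e
  with h  , hs  , h∈  , hs∈  , refl ← ∈-cartesianProductWith⁻ _∷_ (upTo m) (heightVectors m t) p
     | h′ , hs′ , h′∈ , hs′∈ , refl ← ∈-cartesianProductWith⁻ _∷_ (upTo m) (heightVectors m t) q =
  cong₂ _∷_ (e 0 z<s (∈-upTo⁻ h∈) (∈-upTo⁻ h′∈))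
            (heightVectors-ext m t hs∈ hs′∈ (λ c c< → e (suc c) (s<s c<)))

-- If the heights differed, the smaller one, taken as `l`, would lie below the other but not below
-- itself.
<ᵇ-ext : ∀ {n h h′} → h ≤ n → h′ ≤ n → (∀ l → l < n → (l <ᵇ h) ≡ (l <ᵇ h′)) → h ≡ h′
<ᵇ-ext {n} {h} {h′} h≤ h′≤ e = ≤-antisym
  (≮⇒≥ λ lt → <-irrefl refl (<ᵇ-true⇒< {h′} (trans (sym (e h′ (<-≤-trans lt h≤))) (<⇒<ᵇ-true lt))))
  (≮⇒≥ λ lt → <-irrefl refl (<ᵇ-true⇒< {h} (trans (e h (<-≤-trans lt h′≤)) (<⇒<ᵇ-true lt))))

below : (ℕ → ℕ) → ℕ × ℕ → Bool
below ht (c , l) = l <ᵇ ht c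

below-isDownset : ∀ t m ht → IsDownset (Q1 t m) (below ht)
below-isDownset t m ht {c , l} {c′ , l′} _ _ p q
  with p₁ , p₂ ← ∧-true {c ≡ᵇ c′} p with refl ← ≡ᵇ-true⇒≡ {c} p₁ =
  <⇒<ᵇ-true {l} {ht c} (≤-<-trans (≤ᵇ-true⇒≤ {l} p₂) (<ᵇ-true⇒< {l′} {ht c} q))

m^t≤size-Q₂ : ∀ t m → m ^ t ≤ size (Q' t m 1)
m^t≤size-Q₂ t m = subst (_≤ size (Q' t m 1)) (length-heightVectors m t)
  (injection⇒length≤ (λ hs → vec (Q1 t m) (below (entry hs))) (heightVectors-unique m t)
    (λ {hs} _ → vec∈Downsets (Q1 t m) (below-isDownset t m (entry hs)))
    (λ {hs} {hs′} p q e → heightVectors-ext m t p q λ c c< h< h′< →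
      <ᵇ-ext (∸-monoˡ-≤ 1 h<) (∸-monoˡ-≤ 1 h′<) λ l l< →
        map-≡⇒∈ {f = below (entry hs)} {g = below (entry hs′)} e (∈-Q1⁺ t m c< l<)))

-- Growth of |Q_i| and a_i

n<2^n : ∀ n → n < 2 ^ n
n<2^n zero    = z<s
n<2^n (suc n) = begin
  suc (suc n)       ≤⟨ s≤s (n<2^n n) ⟩
  1 + 2 ^ n         ≤⟨ +-monoˡ-≤ (2 ^ n) (m^n>0 2 n) ⟩
  2 ^ n + 2 ^ n     ≡⟨ cong (2 ^ n +_) (+-identityʳ (2 ^ n)) ⟨
  2 ^ suc n         ∎
  where open ≤-Reasoning

^-distribʳ-* : ∀ a b n → (a * b) ^ n ≡ a ^ n * b ^ n
^-distribʳ-* a b zero    = refl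
^-distribʳ-* a b (suc n) = trans (cong (a * b *_) (^-distribʳ-* a b n)) ([m*n]*[o*p]≡[m*o]*[n*p] a b (a ^ n) (b ^ n))

^-cancelʳ-≤ : ∀ {a b} n .{{_ : NonZero n}} → a ^ n ≤ b ^ n → a ≤ b
^-cancelʳ-≤ n p = ≮⇒≥ λ b<a → <⇒≱ (^-monoˡ-< n b<a) p

-- Divide n = 2c·w + r: then 2^n ≥ (w+1)^(2c), and (w+1)² > n as soon as w + 1 ≥ 2c.
polynomial≤exponential : ∀ c n → 4 * (c * c) ≤ n → suc n ^ c ≤ 2 ^ n
polynomial≤exponential zero    n _ = m^n>0 2 n
polynomial≤exponential (suc c₁) n h = begin
  suc n ^ c          ≤⟨ ^-monoˡ-≤ c n< ⟩
  (suc w * suc w) ^ c ≡⟨ ^-distribʳ-* (suc w) (suc w) c ⟩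
  suc w ^ c * suc w ^ c ≡⟨ ^-distribˡ-+-* (suc w) c c ⟨
  suc w ^ (c + c)    ≤⟨ ^-monoˡ-≤ (c + c) (n<2^n w) ⟩
  (2 ^ w) ^ (c + c)  ≡⟨ ^-*-assoc 2 w (c + c) ⟩
  2 ^ (w * (c + c))  ≤⟨ ^-monoʳ-≤ 2 (m/n*n≤m n (c + c)) ⟩
  2 ^ n              ∎
  where
  open ≤-Reasoning
  c = suc c₁
  w = n / (c + c)
  d≤w : c + c ≤ w
  d≤w = subst (_≤ w) (m*n/n≡m (c + c) (c + c)) (/-mono-≤ (subst (_≤ n) (square c) h) ≤-refl)
    where
    square : ∀ c → 4 * (c * c) ≡ (c + c) * (c + c)
    square = solve-∀
  n< : suc n ≤ suc w * suc w
  n< = begin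
    suc n                       ≡⟨ cong suc (m≡m%n+[m/n]*n n (c + c)) ⟩
    suc (n % (c + c)) + w * (c + c) ≤⟨ +-monoˡ-≤ (w * (c + c)) (m%n<n n (c + c)) ⟩
    suc w * (c + c)             ≤⟨ *-monoʳ-≤ (suc w) (m≤n⇒m≤1+n d≤w) ⟩
    suc w * suc w               ∎

-- `A` is a lower bound for lg `Y`, so it is enough to compare `X / Y` with a power of `A`: every
-- rational `x / b` that `LgBound` tests is then less than `A`.
LgBound-intro : ∀ {X Y Z} A num den → X ≡ Y * Z → 2 ^ A ≤ Y → Z ^ den ≤ A ^ num → LgBound X Y num den
LgBound-intro {X} {Y} {Z} A num den refl 2^A≤Y Z≤A x b _ lt = begin
  2 ^ x       ≤⟨ ^-monoʳ-≤ 2 (<⇒≤ x<) ⟩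
  2 ^ (A * b) ≡⟨ ^-*-assoc 2 A b ⟨
  (2 ^ A) ^ b ≤⟨ ^-monoˡ-≤ b 2^A≤Y ⟩
  Y ^ b       ∎
  where
  open ≤-Reasoning
  x< : x < A * b
  x< = ≰⇒> λ Ab≤x → <⇒≱ lt (begin
    b ^ num * (Y * Z) ^ den       ≡⟨ cong (b ^ num *_) (^-distribʳ-* Y Z den) ⟩
    b ^ num * (Y ^ den * Z ^ den) ≤⟨ *-monoʳ-≤ (b ^ num) (*-monoʳ-≤ (Y ^ den) Z≤A) ⟩
    b ^ num * (Y ^ den * A ^ num) ≡⟨ rotate (b ^ num) (Y ^ den) (A ^ num) ⟩
    A ^ num * b ^ num * Y ^ den   ≡⟨ cong (_* Y ^ den) (^-distribʳ-* A b num) ⟨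
    (A * b) ^ num * Y ^ den       ≤⟨ *-monoˡ-≤ (Y ^ den) (^-monoˡ-≤ num Ab≤x) ⟩
    x ^ num * Y ^ den             ∎)
    where
    rotate : ∀ u v w → u * (v * w) ≡ w * u * v
    rotate = solve-∀

n≤n^ : ∀ n c .{{_ : NonZero c}} → n ≤ n ^ c
n≤n^ zero    c       = z≤n
n≤n^ (suc n) (suc c) = m≤m*n (suc n) (suc n ^ c) {{m^n≢0 (suc n) c}}

-- The two regimes of "tm is large": either m alone is large, or t is, and then 2 ^ (t - 1) already suffices.
power-large : ∀ c d m → 1 ≤ d → 2 ≤ m → let T = suc (4 * (suc c * suc c)) in
  T * T ^ suc c ≤ suc d * m → suc d * (suc d ⊔ T) ^ c ≤ m ^ d
power-large c d m 1≤d 2≤m N≤ = case ≤-total t T of λ where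
    (inj₁ t≤T) → begin
      t * (t ⊔ T) ^ c ≡⟨ cong (λ u → t * u ^ c) (m≤n⇒m⊔n≡n t≤T) ⟩
      t * T ^ c       ≤⟨ *-monoˡ-≤ (T ^ c) t≤T ⟩
      T ^ suc c       ≤⟨ *-cancelˡ-≤ T (≤-trans N≤ (*-monoˡ-≤ m t≤T)) ⟩
      m               ≤⟨ n≤n^ m d ⟩
      m ^ d           ∎
    (inj₂ T≤t) → begin
      t * (t ⊔ T) ^ c ≡⟨ cong (λ u → t * u ^ c) (m≥n⇒m⊔n≡m T≤t) ⟩
      -- `T` is one more than the threshold of `polynomial≤exponential` for the exponent `suc c`,
      -- and `t` is one more than `d`.
      t ^ suc c       ≤⟨ polynomial≤exponential (suc c) d (≤-pred T≤t) ⟩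
      2 ^ d           ≤⟨ ^-monoˡ-≤ d 2≤m ⟩
      m ^ d           ∎
  where
  open ≤-Reasoning
  t = suc d
  T = suc (4 * (suc c * suc c))
  instance
    d≢0 : NonZero d
    d≢0 = >-nonZero 1≤d

-- To be read with `suc d` as `t`, `S` as |Q₂| and `A` as a₂; the lower bound on `S` counts height
-- vectors, the upper one counts levels.
module Grid (d m S A : ℕ) (1≤d : 1 ≤ d) (2≤m : 2 ≤ m)
            (S≥ : m ^ suc d ≤ S) (S≤ : S ≤ suc d * m * A) where

  open ≤-Reasoning

  private
    t = suc d
    instance
      m≢0 : NonZero m
      m≢0 = >-nonZero (≤-trans (n≤1+n 1) 2≤m)
      d≢0 : NonZero d
      d≢0 = >-nonZero 1≤d
      S≢0 : NonZero S
      S≢0 = >-nonZero (≤-trans (m^n>0 m t) S≥)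

  private
    swap : ∀ t m A → t * m * A ≡ m * (t * A)
    swap = solve-∀

  m^d≤tA : m ^ d ≤ t * A
  m^d≤tA = *-cancelˡ-≤ m (begin
    m * m ^ d   ≤⟨ ≤-trans S≥ S≤ ⟩
    t * m * A   ≡⟨ swap t m A ⟩
    m * (t * A) ∎)

  -- Raising `S ≤ m * (t * A)` to the power `t` turns `m` into `m ^ t ≤ S`, so one factor `S`
  -- cancels. The resulting exponent `1 + 1/d` is the source of the term 1/(t - 1).
  S^d≤ : S ^ d ≤ (t * A) ^ suc d
  S^d≤ = *-cancelˡ-≤ S (begin
    S ^ suc d                   ≤⟨ ^-monoˡ-≤ (suc d) S≤ ⟩
    (t * m * A) ^ suc d         ≡⟨ cong (_^ suc d) (swap t m A) ⟩
    (m * (t * A)) ^ suc d       ≡⟨ ^-distribʳ-* m (t * A) (suc d) ⟩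
    m ^ suc d * (t * A) ^ suc d ≤⟨ *-monoˡ-≤ ((t * A) ^ suc d) S≥ ⟩
    S * (t * A) ^ suc d         ∎)

  S≤A³ : t ^ 2 ≤ A → 1 ≤ A → S ≤ A ^ 3
  S≤A³ t²≤A 1≤A = ^-cancelʳ-≤ d (begin
    S ^ d             ≤⟨ S^d≤ ⟩
    (t * A) ^ suc d   ≤⟨ ^-monoʳ-≤ (t * A) (+-mono-≤ 1≤d (≤-reflexive (sym (+-identityʳ d)))) ⟩
    (t * A) ^ (2 * d) ≡⟨ ^-*-assoc (t * A) 2 d ⟨
    ((t * A) ^ 2) ^ d ≤⟨ ^-monoˡ-≤ d (begin
      (t * A) ^ 2   ≡⟨ ^-distribʳ-* t A 2 ⟩
      t ^ 2 * A ^ 2 ≤⟨ *-monoˡ-≤ (A ^ 2) t²≤A ⟩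
      A ^ 3         ∎) ⟩
    (A ^ 3) ^ d       ∎)
    where
    instance
      tA≢0 : NonZero (t * A)
      tA≢0 = m*n≢0 t A {{_}} {{>-nonZero 1≤A}}

  -- Divided by `q * d`, the right-hand exponent is 2 + 1/d + p/q: `S` contributes 1 + 1/d, the
  -- factor `t * A` contributes 1, and p/q absorbs the powers of `t`.
  exponent-3 : ∀ p q → 1 ≤ p → 1 ≤ A → t ^ (3 * q) ≤ A →
    (S * (t * A)) ^ (q * d) ≤ A ^ (2 * q * d + q + p * d)
  exponent-3 p q 1≤p 1≤A t^3q≤A = begin
    (S * B) ^ (q * d)             ≡⟨ cong ((S * B) ^_) (*-comm q d) ⟩
    (S * B) ^ (d * q)             ≡⟨ ^-*-assoc (S * B) d q ⟨
    ((S * B) ^ d) ^ q             ≡⟨ cong (_^ q) (^-distribʳ-* S B d) ⟩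
    (S ^ d * B ^ d) ^ q           ≤⟨ ^-monoˡ-≤ q (*-monoˡ-≤ (B ^ d) S^d≤) ⟩
    (B ^ suc d * B ^ d) ^ q       ≡⟨ cong (_^ q) (^-distribˡ-+-* B (suc d) d) ⟨
    (B ^ (suc d + d)) ^ q         ≡⟨ ^-*-assoc B (suc d + d) q ⟩
    B ^ e                         ≡⟨ ^-distribʳ-* t A e ⟩
    t ^ e * A ^ e                 ≤⟨ *-monoˡ-≤ (A ^ e) t^e≤ ⟩
    A ^ (p * d) * A ^ e           ≡⟨ ^-distribˡ-+-* A (p * d) e ⟨
    A ^ (p * d + e)               ≡⟨ cong (A ^_) (exponents p q d) ⟩
    A ^ (2 * q * d + q + p * d)   ∎
    where
    B = t * A
    e = (suc d + d) * q
    instance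
      A≢0 : NonZero A
      A≢0 = >-nonZero 1≤A

    exponents : ∀ p q d → p * d + (suc d + d) * q ≡ 2 * q * d + q + p * d
    exponents = solve-∀

    triple : ∀ q d → (d + d + d) * q ≡ 3 * q * d
    triple = solve-∀

    t^e≤ : t ^ e ≤ A ^ (p * d)
    t^e≤ = begin
      -- Here `1 ≤ d` replaces `suc d + d` by `3 * d`, whence the exponent `3 * q` in the hypothesis
      -- on `A`.
      t ^ e             ≤⟨ ^-monoʳ-≤ t (*-monoˡ-≤ q (+-monoˡ-≤ d (+-monoˡ-≤ d 1≤d))) ⟩
      t ^ ((d + d + d) * q) ≡⟨ cong (t ^_) (triple q d) ⟩
      t ^ (3 * q * d)   ≡⟨ ^-*-assoc t (3 * q) d ⟨
      (t ^ (3 * q)) ^ d ≤⟨ ^-monoˡ-≤ d t^3q≤A ⟩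
      A ^ d             ≤⟨ ^-monoʳ-≤ A (m≤n*m d p {{>-nonZero 1≤p}}) ⟩
      A ^ (p * d)       ∎

-- Indices are shifted by one: `s i` is the size of `Q_{i+1}`, `α i` its largest antichain and `π i`
-- the product a₁ ⋯ a_{i+1}.
module Tower (s α π : ℕ → ℕ)
  (2^α≤s : ∀ i → 2 ^ α i ≤ s (suc i))
  (s≤    : ∀ i → s (suc i) ≤ suc (s i) * α (suc i))
  (π-suc : ∀ i → π (suc i) ≡ π i * α (suc i))
  (q : ℕ) (1≤q : 1 ≤ q) where

  open ≤-Reasoning

  -- The 4 is lost to the factor `α₀ ^ 4` in `s-suc≤`; the remaining `8 * q` is what `exponent-k`
  -- consumes.
  c = 4 + 8 * q

  -- The invariant carried up the tower; `α-large` makes `polynomial≤exponential` applicable with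
  -- exponent `c`.
  record Large (i : ℕ) : Set where
    field
      α-large : suc (4 * (c * c)) ≤ α i
      s≤α³    : s i ≤ α i ^ 3
      π≤α⁴    : π i ≤ α i ^ 4

  module Step {i} (L : Large i) where
    open Large L
    private
      α₀ = α i
      α₁ = α (suc i)
      2≤α₀ : 2 ≤ α₀
      2≤α₀ = ≤-trans (s≤s (s≤s z≤n)) α-large
      instance
        α₀≢0 : NonZero α₀
        α₀≢0 = >-nonZero (≤-trans (s≤s z≤n) 2≤α₀)
        q≢0 : NonZero q
        q≢0 = >-nonZero 1≤q

    s-suc≤ : s (suc i) ≤ α₀ ^ 4 * α₁
    s-suc≤ = begin
      s (suc i)              ≤⟨ s≤ i ⟩
      suc (s i) * α₁         ≤⟨ *-monoˡ-≤ α₁ (s≤s s≤α³) ⟩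
      suc (α₀ ^ 3) * α₁      ≤⟨ *-monoˡ-≤ α₁ (+-mono-≤ (m^n>0 α₀ 3) (≤-reflexive (sym (+-identityʳ (α₀ ^ 3))))) ⟩
      2 * α₀ ^ 3 * α₁        ≤⟨ *-monoˡ-≤ α₁ (*-monoˡ-≤ (α₀ ^ 3) 2≤α₀) ⟩
      α₀ ^ 4 * α₁            ∎

    -- The size of the next poset is at least `2 ^ α₀`, hence at least `α₀ ^ c`, and at most
    -- `α₀ ^ 4 * α₁`; the common factor `α₀ ^ 4` cancels.
    α^8q≤ : α₀ ^ (8 * q) ≤ α₁
    α^8q≤ = *-cancelˡ-≤ (α₀ ^ 4) {{m^n≢0 α₀ 4}} (begin
      α₀ ^ 4 * α₀ ^ (8 * q) ≡⟨ ^-distribˡ-+-* α₀ 4 (8 * q) ⟨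
      α₀ ^ c                ≤⟨ ^-monoˡ-≤ c (n≤1+n α₀) ⟩
      suc α₀ ^ c            ≤⟨ polynomial≤exponential c α₀ (≤-trans (n≤1+n _) α-large) ⟩
      2 ^ α₀                ≤⟨ 2^α≤s i ⟩
      s (suc i)             ≤⟨ s-suc≤ ⟩
      α₀ ^ 4 * α₁           ∎)

    π-suc≤ : π (suc i) ≤ α₀ ^ 4 * α₁
    π-suc≤ = ≤-trans (≤-reflexive (π-suc i)) (*-monoˡ-≤ α₁ π≤α⁴)

    private
      α^≤ : ∀ {e} → e ≤ 8 → α₀ ^ e ≤ α₁
      α^≤ e≤8 = ≤-trans (^-monoʳ-≤ α₀ (≤-trans e≤8 (m≤m*n 8 q))) α^8q≤

      α₀≤α₁ : α₀ ≤ α₁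
      α₀≤α₁ = ≤-trans (n≤n^ α₀ 8) (α^≤ ≤-refl)

      instance
        α₁≢0 : NonZero α₁
        α₁≢0 = >-nonZero (≤-trans (≤-trans (s≤s z≤n) 2≤α₀) α₀≤α₁)

      square : ∀ e → α₀ ^ 4 * α₁ ≤ α₁ ^ (2 + e)
      square e = begin
        α₀ ^ 4 * α₁  ≤⟨ *-monoˡ-≤ α₁ (α^≤ (m≤m+n 4 4)) ⟩
        α₁ * α₁      ≡⟨ cong (α₁ *_) (*-identityʳ α₁) ⟨
        α₁ ^ 2       ≤⟨ ^-monoʳ-≤ α₁ (m≤m+n 2 e) ⟩
        α₁ ^ (2 + e) ∎

    large-suc : Large (suc i)
    large-suc = record
      { α-large = ≤-trans α-large α₀≤α₁
      ; s≤α³    = ≤-trans s-suc≤ (square 1)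
      ; π≤α⁴    = ≤-trans π-suc≤ (square 2)
      }

    -- Size and product are each at most `α₀ ^ 4 * α₁`. The two factors `α₁` give the 2 in the
    -- exponent 2 + p/q, and p/q absorbs the powers of `α₀`.
    exponent-k : ∀ p → 1 ≤ p → (s (suc i) * π (suc i)) ^ q ≤ α₁ ^ (2 * q + p)
    exponent-k p 1≤p = begin
      (s (suc i) * π (suc i)) ^ q          ≤⟨ ^-monoˡ-≤ q (*-mono-≤ s-suc≤ π-suc≤) ⟩
      (α₀ ^ 4 * α₁ * (α₀ ^ 4 * α₁)) ^ q    ≡⟨ cong (_^ q) ([m*n]*[o*p]≡[m*o]*[n*p] (α₀ ^ 4) α₁ (α₀ ^ 4) α₁) ⟩
      (α₀ ^ 4 * α₀ ^ 4 * (α₁ * α₁)) ^ q    ≡⟨ cong (_^ q) (cong₂ _*_ (^-distribˡ-+-* α₀ 4 4) (cong (α₁ *_) (*-identityʳ α₁))) ⟨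
      (α₀ ^ 8 * α₁ ^ 2) ^ q                ≡⟨ ^-distribʳ-* (α₀ ^ 8) (α₁ ^ 2) q ⟩
      (α₀ ^ 8) ^ q * (α₁ ^ 2) ^ q          ≡⟨ cong₂ _*_ (^-*-assoc α₀ 8 q) (^-*-assoc α₁ 2 q) ⟩
      α₀ ^ (8 * q) * α₁ ^ (2 * q)          ≤⟨ *-monoˡ-≤ (α₁ ^ (2 * q)) (≤-trans α^8q≤ (n≤n^ α₁ p {{>-nonZero 1≤p}})) ⟩
      α₁ ^ p * α₁ ^ (2 * q)                ≡⟨ ^-distribˡ-+-* α₁ p (2 * q) ⟨
      α₁ ^ (p + 2 * q)                     ≡⟨ cong (α₁ ^_) (+-comm p (2 * q)) ⟩
      α₁ ^ (2 * q + p)                     ∎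

  large : Large 1 → ∀ i → Large (suc i)
  large L zero    = L
  large L (suc i) = Step.large-suc (large L i)

-- The two logarithmic bounds

prodA-suc : ∀ t m n → prodA t m (suc n) ≡ prodA t m n * a t m (suc n)
prodA-suc t m n = begin
  product (map f (upTo (suc n)))                ≡⟨ cong (product ∘ map f) (upTo-∷ʳ n) ⟨
  product (map f (upTo n ∷ʳ n))                 ≡⟨ cong product (map-++ f (upTo n) (n ∷ [])) ⟩
  product (map f (upTo n) ++ f n ∷ [])          ≡⟨ product-++ (map f (upTo n)) (f n ∷ []) ⟩
  prodA t m n * (f n * 1)                       ≡⟨ cong (prodA t m n *_) (*-identityʳ (f n)) ⟩
  prodA t m n * f n                             ∎
  where
  open ≡-Reasoning
  f = λ i → a t m (suc i)

module LogBounds (p q : ℕ) (1≤p : 1 ≤ p) (1≤q : 1 ≤ q) where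

  private
    c = 4 + 8 * q
    T = suc (4 * (suc c * suc c))

  threshold : ℕ
  threshold = T * T ^ suc c

  module _ (d m : ℕ) (1≤d : 1 ≤ d) (2≤m : 2 ≤ m) (N≤ : threshold ≤ suc d * m) where

    private
      t = suc d
      s = λ i → size (Q' t m i)
      α = λ i → maxAntichain (Q' t m i)
      π = λ i → prodA t m (suc i)
      A = α 1

    suc-size-Q1≤ : suc (size (Q1 t m)) ≤ t * m
    suc-size-Q1≤ = begin
      suc (size (Q1 t m))  ≡⟨ cong suc (size-Q1 t m) ⟩
      suc (t * (m ∸ 1))    ≤⟨ +-monoˡ-≤ (t * (m ∸ 1)) (s≤s (z≤n {d})) ⟩
      t + t * (m ∸ 1)      ≡⟨ *-suc t (m ∸ 1) ⟨
      t * suc (m ∸ 1)      ≡⟨ cong (t *_) (m+[n∸m]≡n (≤-trans (n≤1+n 1) 2≤m)) ⟩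
      t * m                ∎
      where open ≤-Reasoning

    open Grid d m (s 1) A 1≤d 2≤m (m^t≤size-Q₂ t m)
      (≤-trans (size-Downsets≤ (Q1 t m)) (*-monoˡ-≤ A suc-size-Q1≤))

    open Tower s α π (λ i → 2^maxAntichain≤ (Q'-isPoset t m i)) (λ i → size-Downsets≤ (Q' t m i))
      (λ i → prodA-suc t m (suc i)) q 1≤q hiding (c)

    -- Cancel `t` between `power-large` and `m^d≤tA`. The maximum lets `A` exceed both a power of
    -- `t` and the threshold `T`.
    u^c≤A : (t ⊔ T) ^ c ≤ A
    u^c≤A = *-cancelˡ-≤ t (≤-trans (power-large c d m 1≤d 2≤m N≤) m^d≤tA)

    t^e≤A : ∀ {e} → e ≤ c → t ^ e ≤ A
    t^e≤A e≤c = ≤-trans (^-monoʳ-≤ t e≤c) (≤-trans (^-monoˡ-≤ c (m≤m⊔n t T)) u^c≤A)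

    T≤A : T ≤ A
    T≤A = ≤-trans (n≤n^ T c) (≤-trans (^-monoˡ-≤ c (m≤n⊔m t T)) u^c≤A)

    1≤A : 1 ≤ A
    1≤A = ≤-trans (s≤s z≤n) T≤A

    π₁≤ : π 1 ≤ t * A
    π₁≤ = begin
      prodA t m 2           ≡⟨ prodA-suc t m 1 ⟩
      prodA t m 1 * A       ≡⟨ cong (_* A) (*-identityʳ (α 0)) ⟩
      α 0 * A               ≤⟨ *-monoˡ-≤ A (a₁≤ t m) ⟩
      t * A                 ∎
      where open ≤-Reasoning

    lgBound-3 : LgBound (bound 3 t m) (size (Q t m 3)) (2 * q * d + q + p * d) (q * d)
    lgBound-3 = LgBound-intro A (2 * q * d + q + p * d) (q * d) (*-assoc (s 2) (s 1) (π 1)) (2^maxAntichain≤ (Q'-isPoset t m 1))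
      (≤-trans (^-monoˡ-≤ (q * d) (*-monoʳ-≤ (s 1) π₁≤))
               (exponent-3 p q 1≤p 1≤A (t^e≤A (≤-trans (*-monoˡ-≤ q (m≤m+n 3 5)) (m≤n+m (8 * q) 4)))))

    -- The induction starts at `Q₂`, as `a₁≤` keeps a₁ within `t`, which may stay small while `m`
    -- grows.
    large₁ : Large 1
    large₁ = record
      { α-large = ≤-trans (s≤s (*-monoʳ-≤ 4 (*-mono-≤ (n≤1+n c) (n≤1+n c)))) T≤A
      ; s≤α³    = S≤A³ (t^e≤A (s≤s (s≤s z≤n))) 1≤A
      ; π≤α⁴    = begin
          π 1     ≤⟨ π₁≤ ⟩
          t * A   ≤⟨ *-monoˡ-≤ A (≤-trans (n≤n^ t 1) (t^e≤A (s≤s z≤n))) ⟩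
          A * A   ≡⟨ cong (A *_) (*-identityʳ A) ⟨
          A ^ 2   ≤⟨ ^-monoʳ-≤ A {{>-nonZero 1≤A}} (m≤m+n 2 2) ⟩
          A ^ 4   ∎
      }
      where open ≤-Reasoning

    lgBound-k : ∀ k → 4 ≤ k → LgBound (bound k t m) (size (Q t m k)) (2 * q + p) q
    lgBound-k _ (s≤s (s≤s (s≤s (s≤s {n = i} _)))) =
      -- With `k = 4 + i`, `α (2 + i)` is a_{k-1}, a lower bound for lg |Q_k|.
      LgBound-intro (α (2 + i)) (2 * q + p) q (*-assoc (s (3 + i)) (s (2 + i)) (π (2 + i)))
        (2^maxAntichain≤ (Q'-isPoset t m (2 + i)))
        (Step.exponent-k (large large₁ i) p 1≤p)

-- Monochromatic tight paths

pathEdge-cong : ∀ v v′ k i → (∀ j → j < k → v (i + j) ≡ v′ (i + j)) → pathEdge v k i ≡ pathEdge v′ k i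
pathEdge-cong v v′ k i e = map-cong-∈ (λ j∈ → e _ (∈-upTo⁻ j∈))

pathEdge-∷ʳ : ∀ v k i → pathEdge v (suc k) i ≡ pathEdge v k i ∷ʳ v (i + k)
pathEdge-∷ʳ v k i = trans (cong (map (λ j → v (i + j))) (sym (upTo-∷ʳ k)))
                          (map-++ (λ j → v (i + j)) (upTo k) (k ∷ []))

pathEdge-∷ : ∀ v k i → pathEdge v (suc k) i ≡ v (i + 0) ∷ pathEdge v k (suc i)
pathEdge-∷ v k i = cong (v (i + 0) ∷_) (begin
  map f (applyUpTo suc k)                  ≡⟨ map-applyUpTo suc f k ⟩
  applyUpTo (f ∘ suc) k                    ≡⟨ map-upTo (f ∘ suc) k ⟨
  map (f ∘ suc) (upTo k)                   ≡⟨ map-cong (λ j → cong v (+-suc i j)) (upTo k) ⟩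
  pathEdge v k (suc i)                     ∎)
  where
  open ≡-Reasoning
  f = λ j → v (i + j)

entry-pathEdge : ∀ v {k} i {j} → j < k → entry (pathEdge v k i) j ≡ v (i + j)
entry-pathEdge v {suc k} i {zero}  _ = refl
entry-pathEdge v {suc k} i {suc j} j<k = begin
  entry (pathEdge v (suc k) i) (suc j) ≡⟨ cong (λ e → entry e (suc j)) (pathEdge-∷ v k i) ⟩
  entry (pathEdge v k (suc i)) j       ≡⟨ entry-pathEdge v (suc i) (≤-pred j<k) ⟩
  v (suc i + j)                        ≡⟨ cong v (+-suc i j) ⟨
  v (i + suc j)                        ∎
  where open ≡-Reasoning

pathEdge-entry : ∀ S → pathEdge (entry S) (length S) 0 ≡ S
pathEdge-entry []      = refl
pathEdge-entry (x ∷ S) = trans (pathEdge-∷ (entry (x ∷ S)) (length S) 0) (cong (x ∷_) (pathEdge-entry S))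

Linked-entry : ∀ {S} → Linked _<_ S → ∀ {i} → suc i < length S → entry S i < entry S (suc i)
Linked-entry [-]     {i}     (s≤s ())
Linked-entry (r ∷ l) {zero}  _       = r
Linked-entry (r ∷ l) {suc i} (s≤s p) = Linked-entry l p

Linked-init< : ∀ {S n} → Linked _<_ (S ∷ʳ n) → All (_< n) S
Linked-init< {[]}        _       = []
Linked-init< {x ∷ []}    (r ∷ _) = r ∷ []
Linked-init< {x ∷ y ∷ S} (r ∷ l) with y<n ∷ S<n ← Linked-init< {y ∷ S} l = <-trans r y<n ∷ y<n ∷ S<n

Linked-init : ∀ {S n} → Linked _<_ (S ∷ʳ n) → Linked _<_ S
Linked-init {[]}        _       = []
Linked-init {x ∷ []}    _       = [-]
Linked-init {x ∷ y ∷ S} (r ∷ l) = r ∷ Linked-init l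

-- Here `k = 2 + κ`, so `S` consists of the last k - 1 vertices of a path with `l` edges; for
-- `l = 0` the path is `S` alone.
Path : (κ : ℕ) {t : ℕ} → History t → Fin t → ℕ → List ℕ → Set
Path κ h c l S = Σ (ℕ → ℕ) λ v →
  (∀ i → suc i < suc κ + l → v i < v (suc i)) ×
  (∀ i → i < l → (pathEdge v (2 + κ) i , c) ∈ h) ×
  pathEdge v (suc κ) l ≡ S

module _ {κ t : ℕ} {c : Fin t} where

  Path-zero : ∀ {h S} → Linked _<_ S → length S ≡ suc κ → Path κ h c 0 S
  Path-zero {S = S} lnk len =
    entry S ,
    (λ i i< → Linked-entry lnk (subst (suc i <_) (trans (+-identityʳ (suc κ)) (sym len)) i<)) ,
    (λ _ ()) ,
    subst (λ n → pathEdge (entry S) n 0 ≡ S) len (pathEdge-entry S)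

  Path-⊆ : ∀ {h h′ l S} → (∀ {e} → e ∈ h → e ∈ h′) → Path κ h c l S → Path κ h′ c l S
  Path-⊆ h⊆ (v , inc , edges , end) = v , inc , (λ i i< → h⊆ (edges i i<)) , end

  -- The new edge meets the path in its last k - 1 vertices `x ∷ I`, so `n` can be appended as
  -- vertex number `suc κ + l`.
  Path-suc : ∀ {h l x I n} → Path κ h c l (x ∷ I) → Linked _<_ (x ∷ I ∷ʳ n) →
    (x ∷ I ∷ʳ n , c) ∈ h → Path κ h c (suc l) (I ∷ʳ n)
  Path-suc {h} {l} {x} {I} {n} (v , inc , edges , end) lnk e∈ =
    v′ , inc′ , edges′ , ∷-injectiveʳ (trans (sym (pathEdge-∷ v′ (suc κ) l)) edge-l)
    where
    v′ : ℕ → ℕ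
    v′ i with i <? suc κ + l
    ... | yes _ = v i
    ... | no  _ = n

    v′-old : ∀ {i} → i < suc κ + l → v i ≡ v′ i
    v′-old {i} i< with i <? suc κ + l
    ... | yes _  = refl
    ... | no i≮ = ⊥-elim (i≮ i<)

    v′-new : v′ (l + suc κ) ≡ n
    v′-new with l + suc κ <? suc κ + l
    ... | yes p = ⊥-elim (<-irrefl (+-comm l (suc κ)) p)
    ... | no _  = refl

    edge-l : pathEdge v′ (2 + κ) l ≡ x ∷ I ∷ʳ n
    edge-l = begin
      pathEdge v′ (2 + κ) l                 ≡⟨ pathEdge-∷ʳ v′ (suc κ) l ⟩
      pathEdge v′ (suc κ) l ∷ʳ v′ (l + suc κ) ≡⟨ cong₂ _∷ʳ_ (sym (pathEdge-cong v v′ (suc κ) l λ j j< →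
        v′-old (subst (l + j <_) (+-comm l (suc κ)) (+-monoʳ-< l j<)))) v′-new ⟩
      pathEdge v (suc κ) l ∷ʳ n             ≡⟨ cong (_∷ʳ n) end ⟩
      x ∷ I ∷ʳ n                            ∎
      where open ≡-Reasoning

    -- The only new increase to check; it is read off the last two vertices of the new edge.
    last< : v′ (l + κ) < v′ (suc (l + κ))
    last< = subst₂ _<_
      (entry-pathEdge v′ l (m<n⇒m<1+n (n<1+n κ)))
      (trans (entry-pathEdge v′ l (n<1+n (suc κ))) (cong v′ (+-suc l κ)))
      (Linked-entry (subst (Linked _<_) (sym edge-l) lnk)
        (subst (suc κ <_) (sym (trans (length-map _ (upTo (2 + κ))) (length-upTo (2 + κ)))) (n<1+n (suc κ))))

    inc′ : ∀ i → suc i < suc κ + suc l → v′ i < v′ (suc i)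
    inc′ i i< = case suc i <? suc κ + l of λ where
      (yes p) → subst₂ _<_ (v′-old (<-trans (n<1+n i) p)) (v′-old p) (inc i p)
      (no ¬p) → subst (λ i → v′ i < v′ (suc i))
        (suc-injective (trans (cong suc (+-comm l κ)) (≤-antisym (≮⇒≥ ¬p) (≤-pred (subst (suc i <_) (+-suc (suc κ) l) i<)))))
        last<

    i+j≤ : ∀ {i j} → i < l → j < 2 + κ → i + j ≤ κ + l
    i+j≤ {i} {j} i<l j< = begin
      i + j       ≤⟨ +-monoʳ-≤ i (≤-pred j<) ⟩
      i + suc κ   ≡⟨ +-suc i κ ⟩
      suc i + κ   ≤⟨ +-monoˡ-≤ κ i<l ⟩
      l + κ       ≡⟨ +-comm l κ ⟩
      κ + l       ∎
      where open ≤-Reasoning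

    edges′ : ∀ i → i < suc l → (pathEdge v′ (2 + κ) i , c) ∈ h
    edges′ i i< with m≤n⇒m<n∨m≡n (≤-pred i<)
    ... | inj₂ refl = subst (λ e → (e , c) ∈ h) (sym edge-l) e∈
    ... | inj₁ i<l  = subst (λ e → (e , c) ∈ h)
      (pathEdge-cong v v′ (2 + κ) i (λ j j< → v′-old (s≤s (i+j≤ i<l j<)))) (edges i i<l)

BuilderWins-≤ : ∀ {k m t N N′ h} → N ≤ N′ → BuilderWins k m t N h → BuilderWins k m t N′ h
BuilderWins-≤ _       (won p)              = won p
BuilderWins-≤ (s≤s p) (play e len lnk e∉ w) = play e len lnk e∉ (λ c → BuilderWins-≤ p (w c))

-- Labels

-- `ht S c` stands for the length of a path in colour `c` known to end in `S`. Colours are natural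
-- numbers, as in the elements of `Q₁`.
Heights : Set
Heights = List ℕ → ℕ → ℕ

-- Vertices are numbered from 0, so there is no vertex before the junk value hd [] = 0.
hd : List ℕ → ℕ
hd []      = 0
hd (x ∷ _) = x

hd-< : ∀ {n S} → All (_< n) S → ∀ {u} → u < hd S → u < n
hd-< (x<n ∷ _) u<x = <-trans u<x x<n

raise : Heights → List ℕ → ℕ → ℕ → Heights
raise ht S₀ c₀ l S c with ≡-dec _≟_ S S₀ | c ≟ c₀
... | yes _ | yes _ = ht S c ⊔ l
... | _     | _     = ht S c

module _ (ht : Heights) (S₀ : List ℕ) (c₀ l : ℕ) where

  raise-elim : ∀ {R : List ℕ → ℕ → ℕ → Set} {S c} → R S c (ht S c) → R S₀ c₀ l → R S c (raise ht S₀ c₀ l S c)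
  raise-elim {R} {S} {c} old new with ≡-dec _≟_ S S₀ | c ≟ c₀
  ... | yes refl | yes refl = case ⊔-sel (ht S c) l of λ where
                                (inj₁ e) → subst (R S c) (sym e) old
                                (inj₂ e) → subst (R S c) (sym e) new
  ... | yes _    | no _     = old
  ... | no _     | _        = old

  raise-≥ : ∀ S c → ht S c ≤ raise ht S₀ c₀ l S c
  raise-≥ S c with ≡-dec _≟_ S S₀ | c ≟ c₀
  ... | yes _ | yes _ = m≤m⊔n (ht S c) l
  ... | yes _ | no _  = ≤-refl
  ... | no _  | _     = ≤-refl

  raise-new : l ≤ raise ht S₀ c₀ l S₀ c₀
  raise-new with ≡-dec _≟_ S₀ S₀ | c₀ ≟ c₀
  ... | yes _ | yes _ = m≤n⊔m (ht S₀ c₀) l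
  ... | yes _ | no ¬p = ⊥-elim (¬p refl)
  ... | no ¬p | _     = ⊥-elim (¬p refl)

  raise-other : ∀ {S} c → ¬ S ≡ S₀ → ht S c ≡ raise ht S₀ c₀ l S c
  raise-other {S} c S≢ with ≡-dec _≟_ S S₀ | c ≟ c₀
  ... | yes e | _ = ⊥-elim (S≢ e)
  ... | no _  | _ = refl

-- The effect of rounds whose edges end in `n`: heights only rise, and those of sets of earlier
-- vertices are frozen.
record Extends (n : ℕ) (ht ht′ : Heights) : Set where
  field
    grows : ∀ S c → ht S c ≤ ht′ S c
    local : ∀ {S} c → All (_< n) S → ht S c ≡ ht′ S c

Extends-refl : ∀ {n ht} → Extends n ht ht
Extends-refl = record { grows = λ _ _ → ≤-refl ; local = λ _ _ → refl }

Extends-trans : ∀ {n ht ht′ ht″} → Extends n ht ht′ → Extends n ht′ ht″ → Extends n ht ht″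
Extends-trans e e′ = record
  { grows = λ S c → ≤-trans (Extends.grows e S c) (Extends.grows e′ S c)
  ; local = λ c S< → trans (Extends.local e c S<) (Extends.local e′ c S<)
  }

module Labels (t m : ℕ) where

  -- The label of a (k - 1 - j)-set, a down-set of Q_{j+1}.
  lab : ℕ → Heights → List ℕ → List Bool
  lab zero    ht S = vec (Q1 t m) (below (ht S))
  lab (suc j) ht S = vec (Q' t m (suc j)) (↓ (Q' t m (suc j)) (map (λ u → lab j ht (u ∷ S)) (upTo (hd S))))

  leftLabels : ℕ → Heights → List ℕ → List (List Bool)
  leftLabels j ht S = map (λ u → lab j ht (u ∷ S)) (upTo (hd S))

  ∈-leftLabels⁺ : ∀ j ht {S u} → u < hd S → lab j ht (u ∷ S) ∈ leftLabels j ht S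
  ∈-leftLabels⁺ j ht {S} u< = ∈-map⁺ (λ u → lab j ht (u ∷ S)) (∈-upTo⁺ u<)

  ∈-leftLabels⁻ : ∀ j ht {S y} → y ∈ leftLabels j ht S → ∃ λ u → u < hd S × y ≡ lab j ht (u ∷ S)
  ∈-leftLabels⁻ j ht {S} y∈ with u , u∈ , y≡ ← ∈-map⁻ (λ u → lab j ht (u ∷ S)) y∈ = u , ∈-upTo⁻ u∈ , y≡

  lab∈ : ∀ j ht S → lab j ht S ∈ elems (Q' t m (suc j))
  lab∈ zero    ht S = vec∈Downsets (Q1 t m) (below-isDownset t m (ht S))
  lab∈ (suc j) ht S = vec∈Downsets (Q' t m (suc j)) (↓-isDownset (Q'-isPoset t m (suc j)) {leftLabels j ht S} λ y∈ →
    let u , _ , y≡ = ∈-leftLabels⁻ j ht {S} y∈ in subst (_∈ elems (Q' t m (suc j))) (sym y≡) (lab∈ j ht (u ∷ S)))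

  lab-trans : ∀ j {ht ht′ ht″ S S′ S″} → lab j ht S ⊑ lab j ht′ S′ ≡ true →
    lab j ht′ S′ ⊑ lab j ht″ S″ ≡ true → lab j ht S ⊑ lab j ht″ S″ ≡ true
  lab-trans j {ht} {ht′} {ht″} {S} {S′} {S″} =
    IsPoset.≼-trans (Q'-isPoset t m (suc j)) (lab∈ j ht S) (lab∈ j ht′ S′) (lab∈ j ht″ S″)

  lab-mono : ∀ {n ht ht′} → Extends n ht ht′ → ∀ j S → lab j ht S ⊑ lab j ht′ S ≡ true
  lab-mono {ht = ht} {ht′} ext zero S = map-⊑⁺ (elems (Q1 t m)) λ {(c , l)} _ p →
    <⇒<ᵇ-true {l} (<-≤-trans (<ᵇ-true⇒< {l} p) (Extends.grows ext S c))
  lab-mono {ht = ht} {ht′} ext (suc j) S = map-⊑⁺ (elems (Q' t m (suc j))) λ {x} x∈ p →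
    let y , y∈ , x⊑y = any-elim {p = x ⊑_} {leftLabels j ht S} p
        u , u< , y≡  = ∈-leftLabels⁻ j ht {S} y∈
    in any-intro {p = x ⊑_} (∈-leftLabels⁺ j ht′ {S} u<)
         (IsPoset.≼-trans (Q'-isPoset t m (suc j)) x∈ (lab∈ j ht (u ∷ S)) (lab∈ j ht′ (u ∷ S))
           (subst (λ y → x ⊑ y ≡ true) y≡ x⊑y) (lab-mono ext j (u ∷ S)))

  -- The recursion prepends only vertices before `hd S`, so every height consulted belongs to a set
  -- of vertices before `n`.
  lab-local : ∀ {n ht ht′} → Extends n ht ht′ → ∀ j {S} → All (_< n) S → lab j ht S ≡ lab j ht′ S
  lab-local ext zero    S< = map-cong (λ { (c , l) → cong (l <ᵇ_) (Extends.local ext c S<) }) (elems (Q1 t m))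
  lab-local ext (suc j) S< = cong (λ ys → vec (Q' t m (suc j)) (↓ (Q' t m (suc j)) ys))
    (map-cong-∈ λ u∈ → lab-local ext j (hd-< S< (∈-upTo⁻ u∈) ∷ S<))

  -- The left label can only grow and the right one is frozen, so a separation once achieved
  -- persists.
  ⋢-extends : ∀ {n ht ht′} → Extends n ht ht′ → ∀ j {S S′} → All (_< n) S′ →
    ¬ lab j ht S ⊑ lab j ht S′ ≡ true → ¬ lab j ht′ S ⊑ lab j ht′ S′ ≡ true
  ⋢-extends {ht = ht} {ht′} ext j {S} {S′} S′< ¬p p =
    ¬p (lab-trans j {ht} {ht′} {ht} {S} {S} {S′} (lab-mono ext j S)
         (subst (λ y → lab j ht′ S ⊑ y ≡ true) (sym (lab-local ext j S′<)) p))

-- Builder's strategy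

module Strategy (κ t m : ℕ) (2≤t : 2 ≤ t) (2≤m : 2 ≤ m) where

  open Labels t m

  Wins : ℕ → History t → Set
  Wins = BuilderWins (2 + κ) m t

  record Inv (n : ℕ) (h : History t) (ht : Heights) : Set where
    field
      short  : ∀ S c → ht S c < m
      paths  : ∀ S (c : Fin t) → Linked _<_ S → length S ≡ suc κ → Path κ h c (ht S (toℕ c)) S
      -- Guarantees that Builder never wants to present the same edge twice.
      played : ∀ {e} → e ∈ map proj₁ h → ∃ λ x → ∃ λ I → ∃ λ w →
               e ≡ x ∷ I ∷ʳ w × All (_< n) (x ∷ I) × ¬ lab 0 ht (I ∷ʳ w) ⊑ lab 0 ht (x ∷ I) ≡ true

  Separated : ℕ → ℕ → Heights → ℕ → List ℕ → Set
  Separated n j ht x I = ¬ lab j ht (I ∷ʳ n) ⊑ lab j ht (x ∷ I) ≡ true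

  -- Here x ∷ I and I ∷ʳ n are (k - 1 - j)-sets; Extends n reflects that Builder only presents edges
  -- whose last vertex is n.
  CanSeparate : ℕ → ℕ → Set
  CanSeparate j C = ∀ {n h ht} x I → Inv n h ht → Linked _<_ (x ∷ I ∷ʳ n) → length I + j ≡ κ → ∀ {N} →
    (∀ {h′ ht′} → Inv n h′ ht′ → Extends n ht ht′ → Separated n j ht′ x I → Wins N h′) →
    Wins (C + N) h

  -- Present the edge unless the labels are already separated. Its colour `c` prolongs a path ending
  -- in `x ∷ I`, which either wins or raises the height of `I ∷ʳ n` in `c`.
  separate-zero : CanSeparate 0 1
  separate-zero {n} {h} {ht} x I inv lnk len {N} continue with Bool._≟_ (lab 0 ht (I ∷ʳ n) ⊑ lab 0 ht (x ∷ I)) true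
  ... | no  sep = BuilderWins-≤ (n≤1+n N) (continue inv Extends-refl sep)
  ... | yes ⊑x∷I = play e len-e lnk e∉ respond
    where
    open Inv inv
    e = x ∷ I ∷ʳ n

    len-I : length I ≡ κ
    len-I = trans (sym (+-identityʳ (length I))) len

    len-e : length e ≡ 2 + κ
    len-e = cong suc (trans (length-++ I) (trans (+-comm (length I) 1) (cong suc len-I)))

    x∷I< : All (_< n) (x ∷ I)
    x∷I< = Linked-init< {x ∷ I} lnk

    -- Every edge in the history is separated by `played`, contrary to `⊑x∷I`.
    e∉ : e ∉ map proj₁ h
    e∉ e∈ with x′ , I′ , w , e≡ , _ , sep ← played e∈
      with refl ← ∷-injectiveˡ e≡
      with refl , refl ← ∷ʳ-injective I I′ (∷-injectiveʳ e≡) = sep ⊑x∷I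

    respond : ∀ c → Wins N ((e , c) ∷ h)
    respond c = case suc l <? m of λ where
        (no  ¬p) → won (won-path (subst (λ l → Path κ h′ c l (I ∷ʳ n)) (≤-antisym (short (x ∷ I) (toℕ c)) (≮⇒≥ ¬p)) longer))
        (yes p)  → continue (inv′ p) ext (sep′ p)
      where
      h′ = (e , c) ∷ h
      l  = ht (x ∷ I) (toℕ c)

      longer : Path κ h′ c (suc l) (I ∷ʳ n)
      longer = Path-suc (Path-⊆ there (paths (x ∷ I) c (Linked-init {x ∷ I} lnk) (cong suc len-I))) lnk (here refl)

      won-path : Path κ h′ c m (I ∷ʳ n) → MonoPath (2 + κ) m t h′
      won-path (v , inc , edges , _) = v , c , inc , edges

      ht′ = raise ht (I ∷ʳ n) (toℕ c) (suc l)

      ext : Extends n ht ht′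
      ext = record
        { grows = raise-≥ ht (I ∷ʳ n) (toℕ c) (suc l)
        ; local = λ c′ S< → raise-other ht (I ∷ʳ n) (toℕ c) (suc l) c′
            λ { refl → <-irrefl refl (All.lookup S< (∈-++⁺ʳ I (here refl))) }
        }

      -- The witness is `(toℕ c , l)`: it enters the label of `I ∷ʳ n`, while the height of `x ∷ I`
      -- in `c` is still `l`.
      sep′ : suc l < m → Separated n 0 ht′ x I
      sep′ p sub = <-irrefl refl (subst (l <_) (sym (Extends.local ext (toℕ c) x∷I<))
        (<ᵇ-true⇒< {l} (map-⊑⁻ {f = below (ht′ (I ∷ʳ n))} {g = below (ht′ (x ∷ I))} sub
          (∈-Q1⁺ t m (Fin.toℕ<n c) (∸-monoˡ-≤ 1 p))
          (<⇒<ᵇ-true {l} (raise-new ht (I ∷ʳ n) (toℕ c) (suc l))))))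

      inv′ : suc l < m → Inv n h′ ht′
      inv′ p = record
        { short  = λ S c′ → raise-elim ht (I ∷ʳ n) (toℕ c) (suc l) {λ _ _ l → l < m} (short S c′) p
        ; paths  = λ S c′ lnk-S len-S → paths′ S c′ (Path-⊆ there (paths S c′ lnk-S len-S))
        ; played = λ where
            (here refl) → x , I , n , refl , x∷I< , sep′ p
            (there e∈)  → let x , I , w , e≡ , x∷I< , sep = played e∈ in
                          x , I , w , e≡ , x∷I< , ⋢-extends ext 0 {I ∷ʳ w} {x ∷ I} x∷I< sep
        }
        where
        -- Heights are indexed by numbers, so the predicate ranges over all colours with the given
        -- number and injectivity of `toℕ` identifies them.
        paths′ : ∀ S c′ → Path κ h′ c′ (ht S (toℕ c′)) S → Path κ h′ c′ (ht′ S (toℕ c′)) S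
        paths′ S c′ old = raise-elim ht (I ∷ʳ n) (toℕ c) (suc l)
          {λ S i l → ∀ c′ → toℕ c′ ≡ i → Path κ h′ c′ l S}
          (λ c″ e → subst (λ c → Path κ h′ c (ht S (toℕ c′)) S) (sym (Fin.toℕ-injective e)) old)
          (λ c″ e → subst (λ c → Path κ h′ c (suc l) (I ∷ʳ n)) (sym (Fin.toℕ-injective e)) longer)
          c′ refl

  -- Only the maximal labels of the sets u ∷ x ∷ I need to be separated from that of x ∷ I ∷ʳ n.
  separate-suc : ∀ {j C} → CanSeparate j C → CanSeparate (suc j) (maxAntichain (Q' t m (suc j)) * C)
  separate-suc {j} {C} separate {n} {h} {ht} x I inv lnk len {N} continue =
    BuilderWins-≤ (+-monoˡ-≤ N (*-monoˡ-≤ C vs-short)) (run vs (∈-upTo⁻ ∘ vs⊆) inv λ inv′ ext seps →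
      continue inv′ ext (separated ext seps))
    where
    P = Q' t m (suc j)

    label : ℕ → List Bool
    label u = lab j ht (u ∷ x ∷ I)

    maxima = maximal {P = P} (Q'-isPoset t m (suc j)) label (λ u → lab∈ j ht (u ∷ x ∷ I)) (upTo x)
    vs   = proj₁ maxima
    vs⊆  = proj₁ (proj₂ maxima)
    dom  = proj₁ (proj₂ (proj₂ maxima))
    anti = proj₂ (proj₂ (proj₂ maxima))

    vs-short : length vs ≤ maxAntichain P
    vs-short = subst (_≤ maxAntichain P) (length-map label vs)
      (incomparable⇒≤maxAntichain {P = P} (≡-dec Bool._≟_) (Q'-isPoset t m (suc j)) {map label vs}
        (λ y∈ → let v , _ , y≡ = ∈-map⁻ label y∈ in subst (_∈ elems P) (sym y≡) (lab∈ j ht (v ∷ x ∷ I)))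
        (AllPairs.map⁺ anti))

    x∷I< : All (_< n) (x ∷ I)
    x∷I< = Linked-init< {x ∷ I} lnk

    u∷x∷I< : ∀ {u} → u < x → All (_< n) (u ∷ x ∷ I)
    u∷x∷I< u<x = hd-< x∷I< u<x ∷ x∷I<

    run : ∀ us → (∀ {u} → u ∈ us → u < x) → ∀ {h ht} → Inv n h ht →
      (∀ {h′ ht′} → Inv n h′ ht′ → Extends n ht ht′ →
        (∀ {u} → u ∈ us → Separated n j ht′ u (x ∷ I)) → Wins N h′) →
      Wins (length us * C + N) h
    run []       us< inv continue = continue inv Extends-refl (λ ())
    run (u ∷ us) us< {h} inv continue = subst (λ N → Wins N h) (sym (+-assoc C (length us * C) N))
      (separate u (x ∷ I) inv (us< (here refl) ∷ lnk) (trans (sym (+-suc (length I) j)) len) λ inv′ ext sep →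
        run us (us< ∘ there) inv′ λ inv″ ext′ seps →
          continue inv″ (Extends-trans ext ext′) λ where
            (here refl) → ⋢-extends ext′ j {x ∷ I ∷ʳ n} {u ∷ x ∷ I} (u∷x∷I< (us< (here refl))) sep
            (there u∈)  → seps u∈)

    x<hd : ∀ {x I n} → Linked _<_ (x ∷ I ∷ʳ n) → x < hd (I ∷ʳ n)
    x<hd {I = []}    (r ∷ _) = r
    x<hd {I = _ ∷ _} (r ∷ _) = r

    -- Since `x` precedes `I ∷ʳ n`, the element `new` lies in the label of `I ∷ʳ n`. An inclusion
    -- would put it below the label of some `u ∷ x ∷ I`, hence below a representative; these labels
    -- are frozen, so the choice made with `ht` is still valid.
    separated : ∀ {ht′} → Extends n ht ht′ → (∀ {v} → v ∈ vs → Separated n j ht′ v (x ∷ I)) →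
      Separated n (suc j) ht′ x I
    separated {ht′} ext seps sub =
      let y , y∈ , new⊑y = any-elim {p = new ⊑_} {leftLabels j ht′ (x ∷ I)}
            (map-⊑⁻ {f = ↓ P (leftLabels j ht′ (I ∷ʳ n))} {g = ↓ P (leftLabels j ht′ (x ∷ I))} sub
              (lab∈ j ht′ (x ∷ I ∷ʳ n))
              (any-intro {p = new ⊑_} (∈-leftLabels⁺ j ht′ {I ∷ʳ n} (x<hd lnk)) (⊑-refl new)))
          u , u<x , y≡ = ∈-leftLabels⁻ j ht′ {x ∷ I} y∈
          v , v∈ , u⊑v = dom (∈-upTo⁺ u<x)
      in seps v∈ (lab-trans j {ht′} {ht′} {ht′} {x ∷ I ∷ʳ n} {u ∷ x ∷ I} {v ∷ x ∷ I}
           (subst (λ y → new ⊑ y ≡ true) y≡ new⊑y)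
           (subst₂ (λ s s′ → s ⊑ s′ ≡ true) (lab-local ext j (u∷x∷I< u<x))
             (lab-local ext j (u∷x∷I< (∈-upTo⁻ (vs⊆ v∈)))) u⊑v))
      where new = lab j ht′ (x ∷ I ∷ʳ n)

  -- The product a₂ ⋯ a_{j+1}.
  cost : ℕ → ℕ
  cost zero    = 1
  cost (suc j) = maxAntichain (Q' t m (suc j)) * cost j

  separate : ∀ j → CanSeparate j (cost j)
  separate zero    = separate-zero
  separate (suc j) = separate-suc (separate j)

  a₁*cost≡prodA : ∀ j → maxAntichain (Q1 t m) * cost j ≡ prodA t m (suc j)
  a₁*cost≡prodA zero    = refl
  a₁*cost≡prodA (suc j) = begin
    a₁ * (α * cost j)            ≡⟨ cong (a₁ *_) (*-comm α (cost j)) ⟩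
    a₁ * (cost j * α)            ≡⟨ *-assoc a₁ (cost j) α ⟨
    a₁ * cost j * α              ≡⟨ cong (_* α) (a₁*cost≡prodA j) ⟩
    prodA t m (suc j) * α        ≡⟨ prodA-suc t m (suc j) ⟨
    prodA t m (2 + j)            ∎
    where
    open ≡-Reasoning
    a₁ = maxAntichain (Q1 t m)
    α = maxAntichain (Q' t m (suc j))

  -- As `k = 2 + κ`, these are |Q_k|, |Q_{k-1}| and a₂ ⋯ a_{k-1}.
  M = size (Q' t m (suc κ))
  H = size (Q' t m κ)
  C = cost κ

  vlab : Heights → ℕ → List Bool
  vlab ht u = lab κ ht (u ∷ [])

  length-vlab : ∀ ht u → length (vlab ht u) ≡ H
  length-vlab ht u = ∈-Downsets⇒length (Q' t m κ) (lab∈ κ ht (u ∷ []))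

  Distinct : ℕ → Heights → Set
  Distinct n ht = ∀ {u u′} → u < n → u′ < n → vlab ht u ≡ vlab ht u′ → u ≡ u′

  Distinct⇒≤ : ∀ {n ht} → Distinct n ht → n ≤ M
  Distinct⇒≤ {n} {ht} dist = subst (_≤ M) (length-upTo n)
    (injection⇒length≤ (vlab ht) (Unique.upTo⁺ n) (λ {u} _ → lab∈ κ ht (u ∷ []))
      (λ u∈ u′∈ → dist (∈-upTo⁻ u∈) (∈-upTo⁻ u′∈)))

  Distinct-suc : ∀ {n ht} → Distinct n ht → (∀ {u} → u < n → ¬ vlab ht u ≡ vlab ht n) → Distinct (suc n) ht
  Distinct-suc dist new u< u′< e with m≤n⇒m<n∨m≡n (≤-pred u<) | m≤n⇒m<n∨m≡n (≤-pred u′<)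
  ... | inj₁ u<n  | inj₁ u′<n = dist u<n u′<n e
  ... | inj₁ u<n  | inj₂ refl = ⊥-elim (new u<n e)
  ... | inj₂ refl | inj₁ u′<n = ⊥-elim (new u′<n (sym e))
  ... | inj₂ refl | inj₂ refl = refl

  -- Every separation from an earlier vertex with the same label enlarges the label of n.
  process : ∀ g {n h ht N} → Inv n h ht → Distinct n ht → H ≤ count (vlab ht n) + g →
    (∀ {h′ ht′} → Inv n h′ ht′ → Distinct (suc n) ht′ → Wins N h′) → Wins (suc g * C + N) h
  process g {n} {h} {ht} {N} inv dist enough continue
    with any? (λ u → ≡-dec Bool._≟_ (vlab ht u) (vlab ht n)) (upTo n)
  ... | no none = BuilderWins-≤ (m≤n+m N (suc g * C))
    (continue inv (Distinct-suc dist λ u<n e → none (lose (∈-upTo⁺ u<n) e)))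
  ... | yes some with u , u∈ , same ← find some =
    subst (λ N → Wins N h) (sym (+-assoc C (g * C) N))
      (separate κ u [] inv (∈-upTo⁻ u∈ ∷ [-]) refl λ inv′ ext sep → again g enough inv′ ext (larger ext sep))
    where
    u<n = ∈-upTo⁻ u∈

    larger : ∀ {ht′} → Extends n ht ht′ → Separated n κ ht′ u [] → count (vlab ht n) < count (vlab ht′ n)
    larger {ht′} ext sep = ≰⇒> λ c≤ → sep (subst (λ s → vlab ht′ n ⊑ s ≡ true)
      (begin
        vlab ht′ n ≡⟨ ⊑∧count≥⇒≡ (vlab ht n) (vlab ht′ n) (trans (length-vlab ht n) (sym (length-vlab ht′ n)))
                        (lab-mono ext κ (n ∷ [])) c≤ ⟨
        vlab ht n  ≡⟨ same ⟨
        vlab ht u  ≡⟨ lab-local ext κ (u<n ∷ []) ⟩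
        vlab ht′ u ∎)
      (⊑-refl (vlab ht′ n)))
      where open ≡-Reasoning

    again : ∀ g → H ≤ count (vlab ht n) + g → ∀ {h′ ht′} → Inv n h′ ht′ → Extends n ht ht′ →
      count (vlab ht n) < count (vlab ht′ n) → Wins (g * C + N) h′
    -- With no fuel left the label already contains all `H` elements of `Q_{k-1}` and cannot grow.
    again zero enough {ht′ = ht′} inv′ ext lt = ⊥-elim (<⇒≱ (begin-strict
      H                            ≤⟨ enough ⟩
      count (vlab ht n) + 0        ≡⟨ +-identityʳ _ ⟩
      count (vlab ht n)            <⟨ lt ⟩
      count (vlab ht′ n)           ∎) (subst (count (vlab ht′ n) ≤_) (length-vlab ht′ n) (count≤length (vlab ht′ n))))
      where open ≤-Reasoning
    again (suc g) enough inv′ ext lt = process g inv′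
      (λ v<n v′<n e → dist v<n v′<n (trans (lab-local ext κ (v<n ∷ [])) (trans e (sym (lab-local ext κ (v′<n ∷ []))))))
      (≤-trans enough (≤-trans (≤-reflexive (+-suc _ g)) (+-monoˡ-≤ g lt)))
      continue

  Inv-suc : ∀ {n h ht} → Inv n h ht → Inv (suc n) h ht
  Inv-suc inv = record
    { short  = short
    ; paths  = paths
    ; played = λ e∈ → let x , I , w , e≡ , x∷I< , sep = played e∈ in x , I , w , e≡ , All.map m<n⇒m<1+n x∷I< , sep
    }
    where open Inv inv

  -- When `f` runs out, `n = suc M` vertices would carry distinct labels in a poset of `M` elements,
  -- so Builder must have won before.
  processAll : ∀ f {n h ht} → n + f ≡ suc M → Inv n h ht → Distinct n ht → Wins (f * (suc H * C)) h
  processAll zero {n} n≡ inv dist =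
    ⊥-elim (<-irrefl refl (subst (_≤ M) (trans (sym (+-identityʳ n)) n≡) (Distinct⇒≤ dist)))
  processAll (suc f) {n} n≡ inv dist = process H inv dist (m≤n+m H _) λ inv′ dist′ →
    processAll f (trans (sym (+-suc n f)) n≡) (Inv-suc inv′) dist′

  inv₀ : Inv 0 [] (λ _ _ → 0)
  inv₀ = record
    { short  = λ _ _ → ≤-trans (n≤1+n 1) 2≤m
    ; paths  = λ S c → Path-zero
    ; played = λ ()
    }

  -- The rounds used involve no a₁; this spare factor of `bound` is at least 2 and covers the step
  -- from `H` to `suc H`.
  rounds≤bound : M * (suc H * C) ≤ bound (2 + κ) t m
  rounds≤bound = begin
    M * (suc H * C)        ≤⟨ *-monoʳ-≤ M (*-monoˡ-≤ C (+-monoˡ-≤ H (1≤size-Q' 2≤t 2≤m κ))) ⟩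
    M * ((H + H) * C)      ≡⟨ rearrange M H C ⟩
    M * H * (2 * C)        ≤⟨ *-monoʳ-≤ (M * H) (*-monoˡ-≤ C (2≤a₁ 2≤t 2≤m)) ⟩
    M * H * (maxAntichain (Q1 t m) * C) ≡⟨ cong (M * H *_) (a₁*cost≡prodA κ) ⟩
    bound (2 + κ) t m      ∎
    where
    open ≤-Reasoning
    rearrange : ∀ M H C → M * ((H + H) * C) ≡ M * H * (2 * C)
    rearrange = solve-∀

  builderWins : OnlineRamseyLe (2 + κ) m t (bound (2 + κ) t m)
  builderWins = BuilderWins-≤ rounds≤bound
    -- Vertex 0 has no earlier vertex to be separated from, so the process starts at `n = 1` with
    -- `M` vertices to go.
    (processAll M refl (Inv-suc inv₀) λ { {zero} {zero} _ _ _ → refl ; {suc _} (s≤s ()) ; {zero} {suc _} _ (s≤s ()) })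

-- The constant ε is the rational `p / q`; the two pairs of numbers passed to `LgBound` are the
-- fractions 2 + 1/(t - 1) + p/q and 2 + p/q.
theorem10 : ((k t m : ℕ) → 2 ≤ k → 2 ≤ t → 2 ≤ m → OnlineRamseyLe k m t (bound k t m))
    ×
    ((p q : ℕ) → 1 ≤ p → 1 ≤ q →
    Σ ℕ λ N → (t m : ℕ) → 2 ≤ t → 2 ≤ m → N ≤ t * m →
    LgBound (bound 3 t m) (size (Q t m 3))
    (2 * q * (t ∸ 1) + q + p * (t ∸ 1)) (q * (t ∸ 1))
    ×
    ((k : ℕ) → 4 ≤ k →
    LgBound (bound k t m) (size (Q t m k)) (2 * q + p) q))
theorem10 =
  (λ { (suc (suc κ)) t m _ 2≤t 2≤m → Strategy.builderWins κ t m 2≤t 2≤m ; (suc zero) _ _ (s≤s ()) }) ,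
  (λ p q 1≤p 1≤q → let open LogBounds p q 1≤p 1≤q in
    threshold , λ { (suc d) m (s≤s 1≤d) 2≤m N≤ → lgBound-3 d m 1≤d 2≤m N≤ , lgBound-k d m 1≤d 2≤m N≤ })
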